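{- Let $G$ be a cyclically 4-edge connected cubic graph containing a cycle of length 6. Then for every cycle $H$ of length 6 in $G$, either $G-V(H)$ has a perfect matching, or $G-V(H)$ is bipartite.
   Context: A graph $G$ is cyclically $k$-edge connected if deleting fewer than $k$ edges of $G$ cannot separate $G$ into two components each of which contains a cycle. $G-V(H)$ denotes the graph obtained from $G$ by deleting all vertices of $H$ together with their incident edges. -}

module Defs where

open import Data.Nat using (ℕ; zero; suc; _+_; _<_; _%_)
open import Data.Bool using (Bool; true; false; if_then_else_)
open import Data.Fin using (Fin; toℕ)
open import Data.List using (List; length; map; allFin)
open import Data.Nat.ListAction using (sum)
open import Data.List.Membership.Propositional using (_∈_)
open import Data.Product using (_×_; _,_; Σ; ∃; ∃-syntax)
open import Data.Empty using (⊥)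
open import Relation.Nullary using (¬_)
open import Relation.Binary.PropositionalEquality using (_≡_; _≢_)
open import Relation.Binary.Construct.Closure.ReflexiveTransitive using (Star)
open import Function.Definitions using (Injective)

record Graph : Set where
  field
    n      : ℕ
    adj    : Fin n → Fin n → Bool
    adj-sym    : ∀ u v → adj u v ≡ adj v u
    adj-irrefl : ∀ v → adj v v ≡ false
open Graph public

Edge : (G : Graph) → Fin (n G) → Fin (n G) → Set
Edge G u v = adj G u v ≡ true

degree : (G : Graph) → Fin (n G) → ℕ
degree G v = sum (map (λ w → if adj G v w then 1 else 0) (allFin (n G)))

Cubic : Graph → Set
Cubic G = ∀ v → degree G v ≡ 3

record CycleIn {N : ℕ} (R : Fin N → Fin N → Set) (m : ℕ) : Set where
  field
    vert      : Fin (3 + m) → Fin N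
    vert-inj  : Injective _≡_ _≡_ vert
    vert-adj  : ∀ i j → toℕ j ≡ suc (toℕ i) % (3 + m) → R (vert i) (vert j)
open CycleIn public

HasCycle : {N : ℕ} → (Fin N → Fin N → Set) → Set
HasCycle R = ∃[ m ] CycleIn R m

EdgeMinus : (G : Graph) → List (Fin (n G) × Fin (n G)) → Fin (n G) → Fin (n G) → Set
EdgeMinus G F u v = Edge G u v × ¬ ((u , v) ∈ F) × ¬ ((v , u) ∈ F)

-- Deleting fewer than k edges cannot separate G into two components each of
-- which contains a cycle: for every set F of fewer than k edges, there are no
-- two cycles of G - F lying in different connected components of G - F.
CyclicallyEdgeConnected : ℕ → Graph → Set
CyclicallyEdgeConnected k G =
  ∀ (F : List (Fin (n G) × Fin (n G))) → length F < k →
  ∀ (m₁ m₂ : ℕ) (C₁ : CycleIn (EdgeMinus G F) m₁) (C₂ : CycleIn (EdgeMinus G F) m₂) →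
  Star (EdgeMinus G F) (vert C₁ Fin.zero) (vert C₂ Fin.zero)
  where import Data.Fin as Fin

OnCycle : {G : Graph} {m : ℕ} → CycleIn (Edge G) m → Fin (n G) → Set
OnCycle H v = ∃[ i ] vert H i ≡ v

EdgeOff : (G : Graph) {m : ℕ} → CycleIn (Edge G) m → Fin (n G) → Fin (n G) → Set
EdgeOff G H u v = Edge G u v × ¬ OnCycle {G} H u × ¬ OnCycle {G} H v

HasPerfectMatchingOff : (G : Graph) {m : ℕ} → CycleIn (Edge G) m → Set
HasPerfectMatchingOff G H =
  Σ (Fin (n G) → Fin (n G) → Bool) λ M →
    (∀ u v → M u v ≡ M v u) ×
    (∀ u v → M u v ≡ true → EdgeOff G H u v) ×
    (∀ v → ¬ OnCycle {G} H v →
       sum (map (λ w → if M v w then 1 else 0) (allFin (n G))) ≡ 1)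

BipartiteOff : (G : Graph) {m : ℕ} → CycleIn (Edge G) m → Set
BipartiteOff G H =
  Σ (Fin (n G) → Bool) λ c → ∀ u v → EdgeOff G H u v → c u ≢ c v

{-# OPTIONS --safe #-}
module Submission where

-- The count closes only because it has no slack: three edges for each of |S| + 2 parts meet exactly
-- the 3|S| + 6 places that can receive them. With |S| + 1 parts, three places would stay free and
-- no equality would be forced. The second extra part is usually won by comparing parities. Here it
-- comes from the construction: in a saturated graph with a missing edge `w₁ w₂`, there is a
-- matching of everything except `w₁` and `w₂`, and if no perfect matching exists, then `w₁`, `w₂`
-- and the mates of the vertices of S lie in pairwise different cliques. Parity enters only where
-- the saturated graph is complete, and there it is the parity of the number of vertices off H: the
-- order of a cubic graph is even, and so is 6.

-- Suppose G - V(H) has no perfect matching. Lovász's proof of Tutte's theorem yields a set S and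
-- |S| + 2 disjoint nonempty unions K t of components of G - V(H) - S; their parity is not needed.
-- In a cyclically 4-edge connected cubic graph a nonempty set of vertices off H is left by at
-- least 3 edges, and by exactly 3 only if it is a single vertex: deleting a vertex with at most
-- one neighbour inside lowers the cut, and if there is none the set contains a cycle, which must
-- not be separated from H by 3 edges. Since S ∪ V(H) can absorb only 3|S| + 6 edges, every K t is
-- a single vertex and all edges leaving S and H end in these vertices. What is left has an empty
-- cut, hence is empty, and S against the rest is a bipartition.

open import Defs
import Algebra.Properties.CommutativeMonoid.Sum
open import Data.Bool as Bool using (true; false; if_then_else_)
open import Data.Empty using (⊥)
open import Data.Fin using (Fin; zero; suc; toℕ; fromℕ<)
open import Data.Fin.Properties using
  (_≟_; any?; all?; pigeonhole; toℕ-injective; toℕ<n; toℕ-fromℕ<)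
open import Data.List using (List; []; _∷_; map; filter; length; allFin; tabulate; cartesianProduct)
open import Data.List.Properties using (map-tabulate; map-++; map-∘)
open import Data.List.Membership.Propositional using (_∈_)
open import Data.List.Membership.Propositional.Properties using
  (∈-filter⁺; ∈-filter⁻; ∈-cartesianProduct⁺; ∈-allFin)
import Data.Nat.ListAction as ListAction
open import Data.Nat.ListAction.Properties using (sum-++)
open import Data.Nat as ℕ using (ℕ; zero; suc; _+_; _*_; _≤_; _<_; z≤n; s≤s)
open import Data.Nat.Divisibility using (_∣_; divides; ∣m+n∣m⇒∣n; ∣⇒≤; n∣m*n)
open import Data.Nat.DivMod using (m<n⇒m%n≡m; n%n≡0)
open import Data.Nat.Properties as ℕₚ using
  (+-0-commutativeMonoid; +-comm; +-assoc; +-mono-≤; +-monoʳ-≤; +-cancelʳ-≤; ≤-refl;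
   ≤-reflexive; ≤-trans; ≤-antisym; <-≤-trans; <-irrefl; ≮⇒≥; ≰⇒>; m≤m+n; m≤n+m; +-identityʳ;
   *-identityʳ; module ≤-Reasoning)
open import Data.Nat.Induction using (<-wellFounded)
open import Induction.WellFounded using (Acc; acc)
open import Data.Product using (∃; ∃-syntax; _×_; _,_; proj₁; proj₂)
open import Data.Sum using (_⊎_; inj₁; inj₂; [_,_]′)
import Data.Sum as Sum
open import Function using (_∘_; id; case_of_)
open import Relation.Binary.Construct.Closure.ReflexiveTransitive using (Star; ε; _◅_)
open import Relation.Binary.PropositionalEquality using
  (_≡_; _≢_; refl; sym; trans; cong; cong₂; subst; subst₂; ≢-sym)
open import Relation.Binary using (tri<; tri≈; tri>)
open import Relation.Nullary using (¬_; Dec; yes; no; does; contradiction)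
open import Relation.Nullary.Decidable using
  (¬?; _×-dec_; _⊎-dec_; _→-dec_; dec-true; dec-false; decidable-stable)
open import Data.Fin.Patterns using (0F; 1F; 2F; 3F; 4F; 5F)
open import Data.Fin.Permutation using (permutation)
open Algebra.Properties.CommutativeMonoid.Sum +-0-commutativeMonoid using
  (∑-comm; ∑-distrib-+; ∑-permute)
  renaming (sum to ∑; sum-cong-≗ to ∑-cong)

private variable
  m : ℕ
  P Q R : Set

-- Indicators and sums over Fin m

⟦_⟧ : Dec P → ℕ
⟦ p ⟧ = if does p then 1 else 0

⟦⟧-yes : (p : Dec P) → P → ⟦ p ⟧ ≡ 1
⟦⟧-yes (yes _) _ = refl
⟦⟧-yes (no ¬a) a = contradiction a ¬a

⟦⟧-no : (p : Dec P) → ¬ P → ⟦ p ⟧ ≡ 0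
⟦⟧-no (yes a) ¬a = contradiction a ¬a
⟦⟧-no (no _)  _  = refl

⟦⟧-mono : (p : Dec P) (q : Dec Q) → (P → Q) → ⟦ p ⟧ ≤ ⟦ q ⟧
⟦⟧-mono (yes a) q f = ≤-reflexive (sym (⟦⟧-yes q (f a)))
⟦⟧-mono (no _)  _ _ = z≤n

⟦⟧-cong : (p : Dec P) (q : Dec Q) → (P → Q) → (Q → P) → ⟦ p ⟧ ≡ ⟦ q ⟧
⟦⟧-cong p q f g = ≤-antisym (⟦⟧-mono p q f) (⟦⟧-mono q p g)

⟦⟧-cover : (p : Dec P) (q : Dec Q) (r : Dec R) → (P → Q ⊎ R) → ⟦ p ⟧ ≤ ⟦ q ⟧ + ⟦ r ⟧
⟦⟧-cover (no _)  _ _ _ = z≤n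
⟦⟧-cover (yes a) q r f with f a
... | inj₁ b = ≤-trans (≤-reflexive (sym (⟦⟧-yes q b))) (m≤m+n _ _)
... | inj₂ c = ≤-trans (≤-reflexive (sym (⟦⟧-yes r c))) (m≤n+m _ _)

⟦⟧-disjoint : (p : Dec P) (q : Dec Q) (r : Dec R) → (Q → P) → (R → P) → (Q → ¬ R) → ⟦ q ⟧ + ⟦ r ⟧ ≤ ⟦ p ⟧
⟦⟧-disjoint p (no _)  r _ g _ = ⟦⟧-mono r p g
⟦⟧-disjoint p (yes b) r f _ h =
  ≤-reflexive (trans (cong suc (⟦⟧-no r (h b))) (sym (⟦⟧-yes p (f b))))

∑-mono : {f g : Fin m → ℕ} → (∀ i → f i ≤ g i) → ∑ f ≤ ∑ g
∑-mono {zero}  _ = z≤n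
∑-mono {suc m} h = +-mono-≤ (h zero) (∑-mono (h ∘ suc))

term≤∑ : (f : Fin m → ℕ) → ∀ i → f i ≤ ∑ f
term≤∑ f zero    = m≤m+n _ _
term≤∑ f (suc i) = ≤-trans (term≤∑ (f ∘ suc) i) (m≤n+m _ _)

∑-mono-< : {f g : Fin m → ℕ} → (∀ i → f i ≤ g i) → ∀ i → f i < g i → ∑ f < ∑ g
∑-mono-< h zero    lt = ℕₚ.+-mono-<-≤ lt (∑-mono (h ∘ suc))
∑-mono-< h (suc i) lt = ℕₚ.+-mono-≤-< (h zero) (∑-mono-< (h ∘ suc) i lt)

∑-tight : {f g : Fin m → ℕ} → (∀ i → f i ≤ g i) → ∑ g ≤ ∑ f → ∀ i → f i ≡ g i
∑-tight h le i = ≤-antisym (h i) (≮⇒≥ λ lt → <-irrefl refl (<-≤-trans (∑-mono-< h i lt) le))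

∑-const : ∀ m k → ∑ {m} (λ _ → k) ≡ m * k
∑-const zero    k = refl
∑-const (suc m) k = cong (k +_) (∑-const m k)

∑-zero : {f : Fin m → ℕ} → (∀ i → f i ≡ 0) → ∑ f ≡ 0
∑-zero {m} h = trans (∑-cong h) (trans (∑-const m 0) (ℕₚ.*-zeroʳ m))

∑-unique≤1 : {Q : Fin m → Set} (Q? : ∀ i → Dec (Q i)) →
             (∀ {i j} → Q i → Q j → i ≡ j) → ∑ (λ i → ⟦ Q? i ⟧) ≤ 1
∑-unique≤1 {zero}  Q? u = z≤n
∑-unique≤1 {suc m} Q? u with Q? zero
... | no _  = ∑-unique≤1 (Q? ∘ suc) λ q q′ → case u q q′ of λ { refl → refl }
... | yes q = s≤s (≤-reflexive (∑-zero λ i → ⟦⟧-no (Q? (suc i)) λ q′ → case u q q′ of λ ()))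

module _ {Q : Fin m → Set} (Q? : ∀ i → Dec (Q i)) where

  ∑-unique : (∀ {i j} → Q i → Q j → i ≡ j) → (r : Dec R) → (∀ i → Q i → R) → ∑ (λ i → ⟦ Q? i ⟧) ≤ ⟦ r ⟧
  ∑-unique u (yes _) _ = ∑-unique≤1 Q? u
  ∑-unique u (no ¬r) f = ≤-reflexive (∑-zero λ i → ⟦⟧-no (Q? i) (¬r ∘ f i))

  ∑-unique≡1 : (∀ {i j} → Q i → Q j → i ≡ j) → ∃ Q → ∑ (λ i → ⟦ Q? i ⟧) ≡ 1
  ∑-unique≡1 u (i , q) =
    ≤-antisym (∑-unique≤1 Q? u) (≤-trans (≤-reflexive (sym (⟦⟧-yes (Q? i) q))) (term≤∑ _ i))

  ∃-other : 2 ≤ ∑ (λ i → ⟦ Q? i ⟧) → ∀ x → ∃[ y ] (y ≢ x × Q y)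
  ∃-other le x with any? (λ y → ¬? (y ≟ x) ×-dec Q? y)
  ... | yes r = r
  ... | no ¬r = contradiction (≤-trans le (∑-unique≤1 Q? λ q q′ → trans (is-x q) (sym (is-x q′))))
                              λ { (s≤s ()) }
    where
    is-x : ∀ {y} → Q y → y ≡ x
    is-x {y} q = decidable-stable (y ≟ x) λ ne → ¬r (y , ne , q)

∑-point : (x : Fin m) → ∑ (λ i → ⟦ i ≟ x ⟧) ≡ 1
∑-point x = ∑-unique≡1 (_≟ x) (λ p q → trans p (sym q)) (x , refl)

∑-point′ : (x : Fin m) → ∑ (λ i → ⟦ x ≟ i ⟧) ≡ 1
∑-point′ x = ∑-unique≡1 (x ≟_) (λ p q → trans (sym p) q) (x , refl)

sum-map-allFin : ∀ m (f : Fin m → ℕ) → ListAction.sum (map f (allFin m)) ≡ ∑ f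
sum-map-allFin m f = trans (cong ListAction.sum (map-tabulate {n = m} id f)) (go m f)
  where
  go : ∀ m (f : Fin m → ℕ) → ListAction.sum (tabulate f) ≡ ∑ f
  go zero    f = refl
  go (suc m) f = cong (f zero +_) (go m (f ∘ suc))

2∣m+m : ∀ m → 2 ∣ m + m
2∣m+m m = divides m (trans (cong (m +_) (sym (+-identityʳ m))) (ℕₚ.*-comm 2 m))

-- The ordered pairs split into those with `u < v` and those with `v < u`; by symmetry of `A` the
-- two halves have the same size.
handshake : {A : Fin m → Fin m → Set} (A? : ∀ u v → Dec (A u v)) →
            (∀ {u v} → A u v → A v u) → (∀ {v} → ¬ A v v) →
            2 ∣ ∑ (λ u → ∑ λ v → ⟦ A? u v ⟧)
handshake {m} A? sy ir = subst (2 ∣_) (sym eq) (2∣m+m half)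
  where
  below : Fin m → Fin m → ℕ
  below u v = ⟦ (toℕ u ℕ.<? toℕ v) ×-dec A? u v ⟧
  above : Fin m → Fin m → ℕ
  above u v = ⟦ (toℕ v ℕ.<? toℕ u) ×-dec A? u v ⟧
  half = ∑ λ u → ∑ (below u)
  split : ∀ u v → ⟦ A? u v ⟧ ≡ below u v + above u v
  split u v = ≤-antisym
    (⟦⟧-cover (A? u v) ((toℕ u ℕ.<? toℕ v) ×-dec A? u v) ((toℕ v ℕ.<? toℕ u) ×-dec A? u v) cmp)
    (⟦⟧-disjoint (A? u v) ((toℕ u ℕ.<? toℕ v) ×-dec A? u v) ((toℕ v ℕ.<? toℕ u) ×-dec A? u v)
      proj₂ proj₂ λ (lt , _) (gt , _) → ℕₚ.<-asym lt gt)
    where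
    cmp : _ → _
    cmp a with ℕₚ.<-cmp (toℕ u) (toℕ v)
    ... | tri< lt _ _ = inj₁ (lt , a)
    ... | tri> _ _ gt = inj₂ (gt , a)
    ... | tri≈ _ e _ with refl ← toℕ-injective e = contradiction a ir
  flip≡ : ∀ u v → above u v ≡ below v u
  flip≡ u v = ⟦⟧-cong ((toℕ v ℕ.<? toℕ u) ×-dec A? u v) ((toℕ v ℕ.<? toℕ u) ×-dec A? v u)
    (λ (l , a) → l , sy a) (λ (l , a) → l , sy a)
  eq : ∑ (λ u → ∑ λ v → ⟦ A? u v ⟧) ≡ half + half
  eq = trans (∑-cong λ u → trans (∑-cong (split u)) (∑-distrib-+ (below u) (above u)))
      (trans (∑-distrib-+ (λ u → ∑ (below u)) (λ u → ∑ (above u)))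
      (cong (half +_) (trans (∑-cong λ u → ∑-cong (flip≡ u)) (∑-comm (λ u v → below v u)))))

-- Finite search that replaces excluded middle. `R` may live in any universe because it will be
-- `Barrier`, which is in `Set₁`.
allOr : ∀ {ℓ} {P : Fin m → Set} {R : Set ℓ} → (∀ i → P i ⊎ R) → (∀ i → P i) ⊎ R
allOr {zero}  f = inj₁ λ ()
allOr {suc m} f with f zero | allOr (f ∘ suc)
... | inj₂ r | _      = inj₂ r
... | inj₁ _ | inj₂ r = inj₂ r
... | inj₁ p | inj₁ q = inj₁ λ { zero → p ; (suc i) → q i }

-- Matchings as involutions

swap : Fin m → Fin m → Fin m → Fin m
swap a b v with v ≟ a | v ≟ b
... | yes _ | _     = b
... | no _  | yes _ = a
... | no _  | no _  = v

swap-left : (a b : Fin m) → swap a b a ≡ b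
swap-left a b with a ≟ a
... | yes _ = refl
... | no ne = contradiction refl ne

swap-right : (a b : Fin m) → swap a b b ≡ a
swap-right a b with b ≟ a | b ≟ b
... | yes e | _     = e
... | no _  | yes _ = refl
... | no _  | no ne = contradiction refl ne

swap-other : {a b v : Fin m} → v ≢ a → v ≢ b → swap a b v ≡ v
swap-other {a = a} {b} {v} p q with v ≟ a | v ≟ b
... | yes e | _     = contradiction e p
... | no _  | yes e = contradiction e q
... | no _  | no _  = refl

swap-involutive : (a b v : Fin m) → swap a b (swap a b v) ≡ v
swap-involutive a b v with v ≟ a | v ≟ b
... | yes refl | _        = swap-right a b
... | no _     | yes refl = swap-left a b
... | no p     | no q     = swap-other p q

record Involution (m : ℕ) : Set where
  field
    mate       : Fin m → Fin m
    involutive : ∀ v → mate (mate v) ≡ v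

  partner : ∀ {u v} → mate u ≡ v → mate v ≡ u
  partner {u} refl = involutive u

  mate-injective : ∀ {u v} → mate u ≡ mate v → u ≡ v
  mate-injective {v = v} e = trans (sym (partner e)) (involutive v)


-- Conjugation by the swap of N x and y re-pairs x with y and N x with N y.
switch : Involution m → Fin m → Fin m → Involution m
switch I x y = record
  { mate       = σ ∘ N ∘ σ
  ; involutive = λ v → trans (cong (σ ∘ N) (swap-involutive (N x) y (N (σ v))))
                 (trans (cong σ (Involution.involutive I (σ v))) (swap-involutive (N x) y v))
  }
  where
  N = Involution.mate I
  σ = swap (N x) y

module Switch (I : Involution m) {x y : Fin m} (x≢y : x ≢ y) (y≢Nx : y ≢ Involution.mate I x)
              (Nx≢x : Involution.mate I x ≢ x) (Ny≢y : Involution.mate I y ≢ y) where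

  open Involution I using (partner; mate-injective; involutive) renaming (mate to N)

  private
    σ = swap (N x) y

  switch-left : Involution.mate (switch I x y) x ≡ y
  switch-left = trans (cong (σ ∘ N) (swap-other (≢-sym Nx≢x) x≢y)) (swap-left (N x) y)

  -- The hypotheses of the module make `x`, `y`, `N x`, `N y` four distinct vertices. The new
  -- involution pairs `x` with `y` and `N x` with `N y` and agrees with `N` elsewhere, so a property
  -- of all pairs of a vertex and its new mate reduces to five cases.
  switch-elim : (Q : Fin m → Fin m → Set) →
                Q x y → Q y x → Q (N x) (N y) → Q (N y) (N x) →
                (∀ v → v ≢ x → v ≢ y → v ≢ N x → v ≢ N y → Q v (N v)) →
                ∀ v → Q v (Involution.mate (switch I x y) v)
  switch-elim Q xy yx xy′ yx′ other v = go (v ≟ x) (v ≟ y) (v ≟ N x) (v ≟ N y)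
    where
    go : Dec (v ≡ x) → Dec (v ≡ y) → Dec (v ≡ N x) → Dec (v ≡ N y) → Q v (Involution.mate (switch I x y) v)
    go (yes refl) _ _ _ = subst (Q x) (sym switch-left) xy
    go (no _) (yes refl) _ _ = subst (Q y) (sym (Involution.partner (switch I x y) switch-left)) yx
    go (no _) (no _) (yes refl) _ = subst (Q (N x))
      (sym (trans (cong (σ ∘ N) (swap-left (N x) y))
                  (swap-other (λ e → x≢y (sym (mate-injective e))) Ny≢y))) xy′
    go (no _) (no _) (no v≢Nx) (yes refl) = subst (Q (N y))
      (sym (trans (cong (σ ∘ N) (swap-other v≢Nx Ny≢y))
                  (trans (cong σ (involutive y)) (swap-right (N x) y)))) yx′
    go (no v≢x) (no v≢y) (no v≢Nx) (no v≢Ny) = subst (Q v)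
      (sym (trans (cong (σ ∘ N) (swap-other v≢Nx v≢y))
                  (swap-other (λ e → v≢x (mate-injective e))
                              (λ e → v≢Ny (sym (partner e)))))) (other v v≢x v≢y v≢Nx v≢Ny)

-- Barriers

record SubGraph {m : ℕ} (P : Fin m → Set) : Set₁ where
  infix 4 _~_ _~?_
  field
    _~_      : Fin m → Fin m → Set
    _~?_     : ∀ u v → Dec (u ~ v)
    ~-sym    : ∀ {u v} → u ~ v → v ~ u
    ~-irrefl : ∀ {v} → ¬ (v ~ v)
    ~-supp   : ∀ {u v} → u ~ v → P u

  ~⇒≢ : ∀ {u v} → u ~ v → u ≢ v
  ~⇒≢ a refl = ~-irrefl a

  -- The involution is total, but `matched` constrains it on `P` only. By `~-sym` and `~-supp` the
  -- mate of a vertex of `P` is again in `P`.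
  record PerfectMatching : Set where
    field
      involution : Involution m
    open Involution involution public using (mate; partner; mate-injective; involutive)
    field
      matched    : ∀ v → P v → v ~ mate v

  NonEdge : Fin m → Fin m → Set
  NonEdge u v = P u × P v × u ≢ v × ¬ (u ~ v)

  -- A weak form of a Tutte barrier: the parts K t, t ∈ T, are unions of components
  -- of the graph minus S, of any parity.
  record Barrier : Set₁ where
    field
      S T      : Fin m → Set
      K        : Fin m → Fin m → Set
      S?       : ∀ v → Dec (S v)
      T?       : ∀ v → Dec (T v)
      K?       : ∀ t v → Dec (K t v)
      size     : 2 + ∑ (λ v → ⟦ S? v ⟧) ≤ ∑ (λ v → ⟦ T? v ⟧)
      root     : ∀ {t} → T t → K t t
      inside   : ∀ {t v} → T t → K t v → P v × ¬ S v
      closed   : ∀ {t u v} → T t → K t u → u ~ v → K t v ⊎ S v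
      disjoint : ∀ {t t′ v} → T t → T t′ → K t v → K t′ v → t ≡ t′

-- Tutte's theorem by adding edges until saturation

module Tutte {m : ℕ} {P : Fin m → Set} (P? : ∀ v → Dec (P v)) where

  open SubGraph using (PerfectMatching; NonEdge; Barrier)

  module _ (A : SubGraph P) where
    open SubGraph A hiding (PerfectMatching; NonEdge; Barrier)

    addEdge : ∀ {u v} → NonEdge A u v → SubGraph P
    addEdge {u} {v} (pu , pv , u≢v , _) = record
      { _~_      = λ a b → a ~ b ⊎ (a ≡ u × b ≡ v) ⊎ (a ≡ v × b ≡ u)
      ; _~?_     = λ a b → (a ~? b) ⊎-dec ((a ≟ u ×-dec b ≟ v) ⊎-dec (a ≟ v ×-dec b ≟ u))
      ; ~-sym    = λ { (inj₁ a) → inj₁ (~-sym a)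
                     ; (inj₂ (inj₁ (p , q))) → inj₂ (inj₂ (q , p))
                     ; (inj₂ (inj₂ (p , q))) → inj₂ (inj₁ (q , p)) }
      ; ~-irrefl = λ { (inj₁ a) → ~-irrefl a
                     ; (inj₂ (inj₁ (p , q))) → u≢v (trans (sym p) q)
                     ; (inj₂ (inj₂ (p , q))) → u≢v (trans (sym q) p) }
      ; ~-supp   = λ { (inj₁ a) → ~-supp a
                     ; (inj₂ (inj₁ (refl , _))) → pu
                     ; (inj₂ (inj₂ (refl , _))) → pv }
      }

    nonEdge? : ∀ u v → Dec (NonEdge A u v)
    nonEdge? u v = P? u ×-dec P? v ×-dec ¬? (u ≟ v) ×-dec ¬? (u ~? v)

    -- Edges occur in a barrier only as a premise of `closed`, so a barrier survives the deletion of
    -- an edge.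
    barrier-addEdge : ∀ {u v} (e : NonEdge A u v) → Barrier (addEdge e) → Barrier A
    barrier-addEdge e b = record
      { S = S ; T = T ; K = K ; S? = S? ; T? = T? ; K? = K? ; size = size ; root = root
      ; inside = inside ; closed = λ t k a → closed t k (inj₁ a) ; disjoint = disjoint }
      where open Barrier b

    -- A perfect matching of the graph without `w₁` and `w₂`. These two are mated to each other all
    -- the same, so that exchanges along alternating paths become a `switch` of the involution.
    record NearMatching (w₁ w₂ : Fin m) : Set where
      field
        involution : Involution m
      open Involution involution public using (mate; partner; mate-injective; involutive)
      field
        mate-w     : mate w₁ ≡ w₂
        matched    : ∀ v → P v → v ≢ w₁ → v ≢ w₂ → v ~ mate v

    close-near : ∀ {w₁ w₂} → w₁ ~ w₂ → NearMatching w₁ w₂ → PerfectMatching A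
    close-near {w₁} {w₂} a near = record { involution = involution ; matched = go }
      where
      open NearMatching near
      go : ∀ v → P v → v ~ mate v
      go v pv with v ≟ w₁ | v ≟ w₂
      ... | yes refl | _        = subst (w₁ ~_) (sym mate-w) a
      ... | no _     | yes refl = subst (w₂ ~_) (sym (partner mate-w)) (~-sym a)
      ... | no p     | no q     = matched v pv p q

    reverse-near : ∀ {w₁ w₂} → NearMatching w₁ w₂ → NearMatching w₂ w₁
    reverse-near near = record
      { involution = involution ; mate-w = partner mate-w
      ; matched = λ v pv p q → matched v pv q p }
      where open NearMatching near

    perfect-or-near : ∀ {u v} (e : NonEdge A u v) → PerfectMatching (addEdge e) →
                      PerfectMatching A ⊎ NearMatching u v
    perfect-or-near {u} {v} e pm = decide (mate u ≟ v)
      where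
      open PerfectMatching pm
      decide : Dec (mate u ≡ v) → PerfectMatching A ⊎ NearMatching u v
      decide (yes uv) = inj₂ (record
        { involution = involution ; mate-w = uv
        ; matched = λ w pw p q → case matched w pw of λ
            { (inj₁ a) → a
            ; (inj₂ (inj₁ (r , _))) → contradiction r p
            ; (inj₂ (inj₂ (r , _))) → contradiction r q } })
      decide (no uv) = inj₁ (record
        { involution = involution
        ; matched = λ w pw → case matched w pw of λ
            { (inj₁ a) → a
            ; (inj₂ (inj₁ (refl , r))) → contradiction r uv
            ; (inj₂ (inj₂ (refl , r))) → contradiction (partner r) uv } })

    -- Along the alternating path from d, each switch makes one more vertex pair agree with
    -- the matching that uses ac, and b is moved to the next vertex of the path.
    module Uncross {a b c : Fin m} (ab : a ~ b) (bc : b ~ c) (ac : NonEdge A a c)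
                   (pm : PerfectMatching (addEdge ac)) where
      open PerfectMatching pm using () renaming
        (mate to mate₁; partner to partner₁; involutive to involutive₁; matched to matched₁)

      disagreements : (Fin m → Fin m) → ℕ
      disagreements N = ∑ λ v → ⟦ ¬? (N v ≟ mate₁ v) ⟧

      uncross : ∀ {x} → P x → b ≢ x → (near : NearMatching b x) →
                Acc _<_ (disagreements (NearMatching.mate near)) → PerfectMatching A
      -- The alternating path stops at `a`, at `c`, or when `mate₁` leads back to `b`. In each case
      -- `x` is adjacent to `b`, which is the one edge that `near` lacks.
      uncross {x} px b≢x near (acc rec) with x ≟ a
      ... | yes refl = close-near (~-sym ab) near
      ... | no x≢a with x ≟ c
      ...   | yes refl = close-near bc near
      ...   | no x≢c with mate₁ x ≟ b | matched₁ x px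
      ...     | _ | inj₂ (inj₁ (e , _)) = contradiction e x≢a
      ...     | _ | inj₂ (inj₂ (e , _)) = contradiction e x≢c
      ...     | yes e | inj₁ xb = close-near (~-sym (subst (x ~_) e xb)) near
      ...     | no y≢b | inj₁ xy = uncross (~-supp (~-sym yz)) b≢z near′ (rec fewer)
        where
        open NearMatching near
        y = mate₁ x
        z = mate y
        x↦b : mate x ≡ b
        x↦b = partner mate-w
        x≢y : x ≢ y
        x≢y = ~⇒≢ xy
        yz : y ~ z
        yz = matched y (~-supp (~-sym xy)) y≢b (≢-sym x≢y)
        y≢mx : y ≢ mate x
        y≢mx e = y≢b (trans e x↦b)
        mx≢x : mate x ≢ x
        mx≢x e = b≢x (trans (sym x↦b) e)
        z≢y : z ≢ y
        z≢y = ≢-sym (~⇒≢ yz)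
        b≢z : b ≢ z
        b≢z e = x≢y (mate-injective (trans x↦b e))
        open Switch involution x≢y y≢mx mx≢x z≢y renaming (switch-elim to elim)
        near′ : NearMatching b z
        near′ = record
          { involution = switch involution x y
          ; mate-w     = elim (λ v w → v ≡ b → w ≡ z)
              (λ e → contradiction (sym e) b≢x) (λ e → contradiction e y≢b) (λ _ → refl)
              (λ e → contradiction (sym e) b≢z)
              (λ v _ _ v≢mx _ e → contradiction (trans e (sym x↦b)) v≢mx) b refl
          ; matched    = elim (λ v w → P v → v ≢ b → v ≢ z → v ~ w)
              (λ _ _ _ → xy) (λ _ _ _ → ~-sym xy)
              (λ _ p _ → contradiction x↦b p) (λ _ _ p → contradiction refl p)
              (λ v v≢x _ _ _ pv v≢b _ → matched v pv v≢b v≢x)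
          }
        open Involution (switch involution x y) using () renaming (mate to mate′)
        fewer : disagreements mate′ < disagreements mate
        -- The pair `x`, `y` comes to agree with `mate₁`. The other two switched vertices, `b` and
        -- `z`, disagreed before: their mates were `x` and `y`, which `mate₁` pairs with each other.
        -- So no new disagreement arises.
        fewer = ∑-mono-<
          (λ v → ⟦⟧-mono (¬? (mate′ v ≟ mate₁ v)) (¬? (mate v ≟ mate₁ v)) (elim
            (λ v w → w ≢ mate₁ v → mate v ≢ mate₁ v)
            (λ ne → contradiction refl ne)
            (λ ne → contradiction (sym (involutive₁ x)) ne)
            (λ _ e → y≢mx (partner₁ (trans (sym e) (involutive x))))
            (λ _ e → y≢mx (sym (partner
              (trans (sym (partner₁ (trans (sym e) (involutive y)))) (involutive₁ x)))))
            (λ _ _ _ _ _ ne → ne) v))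
          x (subst₂ _<_
            (sym (⟦⟧-no (¬? (mate′ x ≟ y)) λ ne → ne switch-left))
            (sym (⟦⟧-yes (¬? (mate x ≟ y)) (≢-sym y≢mx))) (s≤s z≤n))

  module _ (A : SubGraph P) where
    open SubGraph A hiding (PerfectMatching; NonEdge; Barrier)

    Universal : Fin m → Set
    Universal v = P v × (∀ u → P u → u ≢ v → v ~ u)

    universal? : ∀ v → Dec (Universal v)
    universal? v = P? v ×-dec all? (λ u → P? u →-dec (¬? (u ≟ v) →-dec (v ~? u)))

    module _ {w₁ w₂ : Fin m} (w : NonEdge A w₁ w₂) where

      private
        p₁ : P w₁
        p₁ = proj₁ w
        p₂ : P w₂
        p₂ = proj₁ (proj₂ w)
        w₁≢w₂ : w₁ ≢ w₂
        w₁≢w₂ = proj₁ (proj₂ (proj₂ w))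
        w₁≁w₂ : ¬ (w₁ ~ w₂)
        w₁≁w₂ = proj₂ (proj₂ (proj₂ w))

      ¬universal₁ : ¬ Universal w₁
      ¬universal₁ (_ , f) = w₁≁w₂ (f w₂ p₂ (≢-sym w₁≢w₂))

      ¬universal₂ : ¬ Universal w₂
      ¬universal₂ (_ , f) = w₁≁w₂ (~-sym (f w₁ p₁ w₁≢w₂))

      universal~₁ : ∀ {v} → Universal v → w₁ ~ v
      universal~₁ u@(_ , f) = ~-sym (f w₁ p₁ λ { refl → ¬universal₁ u })

      universal~₂ : ∀ {v} → Universal v → w₂ ~ v
      universal~₂ u@(_ , f) = ~-sym (f w₂ p₂ λ { refl → ¬universal₂ u })

      -- The path `w₁`, `y`, `mate y`, `w₂` is augmenting: its middle edge is exchanged for the two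
      -- outer ones.
      reroute : (near : NearMatching A w₁ w₂) → ∀ {y} → w₁ ~ y → w₂ ~ NearMatching.mate near y →
                PerfectMatching A
      reroute near {y} a b = record
        { involution = switch involution w₁ y
        ; matched    = switch-elim (λ v u → P v → v ~ u)
            (λ _ → a) (λ _ → ~-sym a)
            (λ _ → subst (_~ mate y) (sym mate-w) b) (λ _ → subst (mate y ~_) (sym mate-w) (~-sym b))
            (λ v v≢w₁ _ v≢m _ pv → matched v pv v≢w₁ λ e → v≢m (trans e (sym mate-w)))
        }
        where
        open NearMatching near
        y≢w₂ : y ≢ w₂
        y≢w₂ refl = w₁≁w₂ a
        open Switch involution {w₁} {y} (~⇒≢ a) (λ e → y≢w₂ (trans e mate-w))
          (λ e → w₁≢w₂ (trans (sym e) mate-w))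
          (λ e → ~-irrefl (subst (y ~_) e (matched y (~-supp (~-sym a)) (≢-sym (~⇒≢ a)) y≢w₂)))

      universal-pair : (near : NearMatching A w₁ w₂) → ∀ {t} →
                       Universal t → Universal (NearMatching.mate near t) → PerfectMatching A
      universal-pair near u u′ = reroute near (universal~₁ u) (universal~₂ u′)

    nonEdge-sym : ∀ {u v} → NonEdge A u v → NonEdge A v u
    nonEdge-sym (p , q , ne , ¬a) = q , p , ≢-sym ne , ¬a ∘ ~-sym

    module Cliques {w₁ w₂ : Fin m} (w : NonEdge A w₁ w₂) (near : NearMatching A w₁ w₂)
      (~-trans : ∀ {a b c} → ¬ Universal b → a ~ b → b ~ c → a ≢ c → a ~ c) where
      open NearMatching near

      -- Representatives of the parts of the barrier: `w₁`, `w₂` and the mates of universal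
      -- vertices. This is the origin of the excess 2 over the number of universal vertices.
      Special : Fin m → Set
      Special t = ¬ Universal t × (t ≡ w₁ ⊎ t ≡ w₂ ⊎ Universal (mate t))

      special? : ∀ t → Dec (Special t)
      special? t = ¬? (universal? t) ×-dec ((t ≟ w₁) ⊎-dec ((t ≟ w₂) ⊎-dec universal? (mate t)))

      ¬universal-mate₁ : ¬ Universal (mate w₁)
      ¬universal-mate₁ u = ¬universal₂ w (subst Universal mate-w u)

      ¬universal-mate₂ : ¬ Universal (mate w₂)
      ¬universal-mate₂ u = ¬universal₁ w (subst Universal (partner mate-w) u)

      -- If one of the two is `w₁` or `w₂`, the other has a universal mate, and that mate is
      -- adjacent to the remaining end, so the edge starts an augmenting path; `w₁` and `w₂`
      -- themselves are not adjacent.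
      special-adjacent : ∀ {t t′} → Special t → Special t′ → t ~ t′ → PerfectMatching A
      special-adjacent (_ , inj₁ refl) (_ , inj₁ refl) a = contradiction a ~-irrefl
      special-adjacent (_ , inj₁ refl) (_ , inj₂ (inj₁ refl)) a = contradiction a (proj₂ (proj₂ (proj₂ w)))
      special-adjacent (_ , inj₁ refl) (_ , inj₂ (inj₂ u)) a = reroute w near a (universal~₂ w u)
      special-adjacent (_ , inj₂ (inj₁ refl)) (_ , inj₁ refl) a =
        contradiction (~-sym a) (proj₂ (proj₂ (proj₂ w)))
      special-adjacent (_ , inj₂ (inj₁ refl)) (_ , inj₂ (inj₁ refl)) a = contradiction a ~-irrefl
      special-adjacent (_ , inj₂ (inj₁ refl)) (_ , inj₂ (inj₂ u)) a =
        reroute (nonEdge-sym w) (reverse-near A near) a (universal~₁ w u)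
      special-adjacent (_ , inj₂ (inj₂ u)) (_ , inj₁ refl) a = reroute w near (~-sym a) (universal~₂ w u)
      special-adjacent (_ , inj₂ (inj₂ u)) (_ , inj₂ (inj₁ refl)) a =
        reroute (nonEdge-sym w) (reverse-near A near) (~-sym a) (universal~₁ w u)
      -- Re-pairing `t` with `t′` sets their mates free, and these are adjacent because they are
      -- universal. In the new near matching two universal vertices are mated, so `universal-pair`
      -- applies.
      special-adjacent {t} {t′} (¬ut , inj₂ (inj₂ u)) (¬ut′ , inj₂ (inj₂ u′)) a =
        universal-pair w near′ u (subst Universal (sym mate′) u′)
        where
        t≢t′ : t ≢ t′
        t≢t′ = ~⇒≢ a
        t′≢mt : t′ ≢ mate t
        t′≢mt refl = ¬ut′ u
        mt≢t : mate t ≢ t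
        mt≢t e = ¬ut (subst Universal e u)
        mt′≢t′ : mate t′ ≢ t′
        mt′≢t′ e = ¬ut′ (subst Universal e u′)
        mt≢mt′ : mate t ≢ mate t′
        mt≢mt′ e = t≢t′ (mate-injective e)
        mt~mt′ : mate t ~ mate t′
        mt~mt′ = proj₂ u (mate t′) (proj₁ u′) (≢-sym mt≢mt′)
        open Switch involution t≢t′ t′≢mt mt≢t mt′≢t′
        mate′ : Involution.mate (switch involution t t′) (mate t) ≡ mate t′
        mate′ = switch-elim (λ v x → v ≡ mate t → x ≡ mate t′)
          (λ e → contradiction (sym e) mt≢t) (λ e → contradiction e t′≢mt) (λ _ → refl)
          (λ e → contradiction (sym e) mt≢mt′) (λ _ _ _ ne _ e → contradiction e ne) (mate t) refl
        near′ : NearMatching A w₁ w₂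
        near′ = record
          { involution = switch involution t t′
          ; mate-w     = switch-elim (λ v x → v ≡ w₁ → x ≡ w₂)
              (λ { refl → contradiction u ¬universal-mate₁ })
              (λ { refl → contradiction u′ ¬universal-mate₁ })
              (λ e → contradiction (subst Universal e u) (¬universal₁ w))
              (λ e → contradiction (subst Universal e u′) (¬universal₁ w))
              (λ { _ _ _ _ _ refl → mate-w }) w₁ refl
          ; matched    = switch-elim (λ v x → P v → v ≢ w₁ → v ≢ w₂ → v ~ x)
              (λ _ _ _ → a) (λ _ _ _ → ~-sym a) (λ _ _ _ → mt~mt′) (λ _ _ _ → ~-sym mt~mt′)
              (λ v _ _ _ _ → matched v)
          }

      ∑-mate : (f : Fin m → ℕ) → ∑ (f ∘ mate) ≡ ∑ f
      ∑-mate f = sym (∑-permute f (permutation mate mate involutive involutive))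

      -- By `~-trans`, the closed neighbourhood of a non-universal vertex, less the universal
      -- vertices, is a clique and a whole component once these are removed. Two representatives
      -- whose parts meet would therefore be equal or adjacent.
      barrier : (∀ t → ¬ (Universal t × Universal (mate t))) →
                (∀ t t′ → ¬ (Special t × Special t′ × t ~ t′)) → Barrier A
      barrier ¬pair ¬adjacent = record
        { S = Universal ; T = Special ; K = K ; S? = universal? ; T? = special?
        ; K? = λ t v → P? v ×-dec ¬? (universal? v) ×-dec ((t ≟ v) ⊎-dec (t ~? v))
        ; size = size ; root = λ s → special⇒P s , proj₁ s , inj₁ refl
        ; inside = λ _ (p , ¬u , _) → p , ¬u ; closed = closed ; disjoint = disjoint }
        where
        K : Fin m → Fin m → Set
        K t v = P v × ¬ Universal v × (t ≡ v ⊎ t ~ v)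
        special⇒P : ∀ {t} → Special t → P t
        special⇒P (_ , inj₁ refl) = proj₁ w
        special⇒P (_ , inj₂ (inj₁ refl)) = proj₁ (proj₂ w)
        special⇒P {t} (_ , inj₂ (inj₂ u)) = subst P (involutive t) (~-supp (~-sym
          (matched (mate t) (proj₁ u) (λ e → ¬universal₁ w (subst Universal e u))
                                      (λ e → ¬universal₂ w (subst Universal e u)))))
        closed : ∀ {t u v} → Special t → K t u → u ~ v → K t v ⊎ Universal v
        closed {t} {u} {v} _ (_ , ¬u , c) a with universal? v
        ... | yes uv = inj₂ uv
        ... | no ¬uv = inj₁ (~-supp (~-sym a) , ¬uv , clique c)
          where
          clique : t ≡ u ⊎ t ~ u → t ≡ v ⊎ t ~ v
          clique (inj₁ refl) = inj₂ a
          clique (inj₂ b) with t ≟ v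
          ... | yes e = inj₁ e
          ... | no ne = inj₂ (~-trans ¬u b a ne)
        disjoint : ∀ {t t′ v} → Special t → Special t′ → K t v → K t′ v → t ≡ t′
        disjoint {t} {t′} s s′ (_ , ¬u , c) (_ , _ , c′) =
          decidable-stable (t ≟ t′) λ ne → ¬adjacent t t′ (s , s′ , adjacent ¬u ne c c′)
          where
          adjacent : ∀ {v} → ¬ Universal v → t ≢ t′ → t ≡ v ⊎ t ~ v → t′ ≡ v ⊎ t′ ~ v → t ~ t′
          adjacent _ ne (inj₁ refl) (inj₁ refl) = contradiction refl ne
          adjacent _ ne (inj₁ refl) (inj₂ b) = ~-sym b
          adjacent _ ne (inj₂ a) (inj₁ refl) = a
          adjacent ¬u ne (inj₂ a) (inj₂ b) = ~-trans ¬u a (~-sym b) ne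
        -- Since `mate` is a permutation, as many vertices have a universal mate as are universal.
        -- By `¬pair` they are non-universal, and they differ from `w₁` and `w₂`, whose mates are
        -- each other.
        size : 2 + ∑ (λ v → ⟦ universal? v ⟧) ≤ ∑ (λ v → ⟦ special? v ⟧)
        size = begin
          1 + (1 + ∑ (λ v → ⟦ universal? v ⟧))
            ≡⟨ sym (cong₂ (λ a b → a + (b + _)) (∑-point w₁) (∑-point w₂)) ⟩
          ∑ (λ v → ⟦ v ≟ w₁ ⟧) + (∑ (λ v → ⟦ v ≟ w₂ ⟧) + ∑ (λ v → ⟦ universal? v ⟧))
            ≡⟨ sym (cong (λ a → ∑ (λ v → ⟦ v ≟ w₁ ⟧) + (∑ (λ v → ⟦ v ≟ w₂ ⟧) + a)) (∑-mate _)) ⟩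
          ∑ (λ v → ⟦ v ≟ w₁ ⟧) + (∑ (λ v → ⟦ v ≟ w₂ ⟧) + ∑ (λ v → ⟦ universal? (mate v) ⟧))
            ≡⟨ sym (cong (∑ (λ v → ⟦ v ≟ w₁ ⟧) +_) (∑-distrib-+ (λ v → ⟦ v ≟ w₂ ⟧) _)) ⟩
          ∑ (λ v → ⟦ v ≟ w₁ ⟧) + ∑ (λ v → ⟦ v ≟ w₂ ⟧ + ⟦ universal? (mate v) ⟧)
            ≡⟨ sym (∑-distrib-+ (λ v → ⟦ v ≟ w₁ ⟧) _) ⟩
          ∑ (λ v → ⟦ v ≟ w₁ ⟧ + (⟦ v ≟ w₂ ⟧ + ⟦ universal? (mate v) ⟧))
            ≤⟨ ∑-mono pointwise ⟩
          ∑ (λ v → ⟦ special? v ⟧) ∎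
          where
          open ≤-Reasoning
          pointwise : ∀ v → ⟦ v ≟ w₁ ⟧ + (⟦ v ≟ w₂ ⟧ + ⟦ universal? (mate v) ⟧) ≤ ⟦ special? v ⟧
          pointwise v = ≤-trans
            (+-monoʳ-≤ ⟦ v ≟ w₁ ⟧ (⟦⟧-disjoint ((v ≟ w₂) ⊎-dec universal? (mate v))
              (v ≟ w₂) (universal? (mate v)) inj₁ inj₂ λ { refl → ¬universal-mate₂ }))
            (⟦⟧-disjoint (special? v) (v ≟ w₁) ((v ≟ w₂) ⊎-dec universal? (mate v))
              (λ { refl → ¬universal₁ w , inj₁ refl })
              (λ { (inj₁ refl) → ¬universal₂ w , inj₂ (inj₁ refl)
                 ; (inj₂ u) → (λ u′ → ¬pair v (u′ , u)) , inj₂ (inj₂ u) })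
              λ { refl (inj₁ e) → proj₁ (proj₂ (proj₂ w)) e ; refl (inj₂ u) → ¬universal-mate₁ u })

      matching-or-barrier : PerfectMatching A ⊎ Barrier A
      matching-or-barrier with any? (λ t → universal? t ×-dec universal? (mate t))
      ... | yes (t , u , u′) = inj₁ (universal-pair w near u u′)
      ... | no ¬pair with any? (λ t → any? λ t′ → special? t ×-dec special? t′ ×-dec (t ~? t′))
      ...   | yes (_ , _ , s , s′ , a) = inj₁ (special-adjacent s s′ a)
      ...   | no ¬adj = inj₂ (barrier (λ t x → ¬pair (t , x)) (λ t t′ x → ¬adj (t , t′ , x)))

    module Complete (complete : ∀ u v → ¬ NonEdge A u v) (even : 2 ∣ ∑ (λ v → ⟦ P? v ⟧)) where

      unmatched? : (I : Involution m) → ∀ v → Dec (P v × Involution.mate I v ≡ v)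
      unmatched? I v = P? v ×-dec (Involution.mate I v ≟ v)

      -- Joining each vertex to its mate gives a graph in which the moved vertices have degree 1 and
      -- the fixed ones degree 0, so the degree sum counts the moved vertices.
      even-matched : (I : Involution m) → 2 ∣ ∑ (λ v → ⟦ ¬? (Involution.mate I v ≟ v) ⟧)
      even-matched I = subst (2 ∣_) (∑-cong row)
        (handshake pair? (λ { (refl , ne) → involutive _ , ≢-sym ne }) λ (_ , ne) → ne refl)
        where
        open Involution I
        pair? : ∀ u v → Dec (mate u ≡ v × u ≢ v)
        pair? u v = (mate u ≟ v) ×-dec ¬? (u ≟ v)
        unique : ∀ {u v v′} → mate u ≡ v × u ≢ v → mate u ≡ v′ × u ≢ v′ → v ≡ v′
        unique (p , _) (q , _) = trans (sym p) q
        row : ∀ u → ∑ (λ v → ⟦ pair? u v ⟧) ≡ ⟦ ¬? (mate u ≟ u) ⟧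
        row u with mate u ≟ u
        ... | yes e = ∑-zero λ v → ⟦⟧-no (pair? u v) λ (p , ne) → ne (trans (sym e) p)
        ... | no ne = ∑-unique≡1 (pair? u) unique (mate u , refl , ≢-sym ne)

      -- As `mate` fixes `x` and `y`, it commutes with their transposition, and the composite is
      -- again an involution.
      join : (I : Involution m) → ∀ {x y} → Involution.mate I x ≡ x → Involution.mate I y ≡ y → Involution m
      join I {x} {y} ex ey = record { mate = σ ∘ mate ; involutive = λ v → go v (mate v ≟ x) (mate v ≟ y) }
        where
        open Involution I
        σ = swap x y
        go : ∀ v → Dec (mate v ≡ x) → Dec (mate v ≡ y) → σ (mate (σ (mate v))) ≡ v
        go v (yes e) _ = trans (cong (σ ∘ mate) (trans (cong σ e) (swap-left x y)))
          (trans (cong σ ey) (trans (swap-right x y) (trans (sym ex) (partner e))))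
        go v (no _) (yes e) = trans (cong (σ ∘ mate) (trans (cong σ e) (swap-right x y)))
          (trans (cong σ ex) (trans (swap-left x y) (trans (sym ey) (partner e))))
        go v (no p) (no q) = trans (cong (σ ∘ mate) (swap-other p q)) (trans (cong σ (involutive v))
          (swap-other (λ { refl → p ex }) (λ { refl → q ey })))

      -- In a complete graph any two unmatched vertices can be joined. A single one cannot be left
      -- over, since both `P` and the set of moved vertices have even size.
      greedy : (I : Involution m) → (∀ v → Involution.mate I v ≢ v → P v) →
               Acc _<_ (∑ λ v → ⟦ unmatched? I v ⟧) → PerfectMatching A
      greedy I supp (acc rec) with any? (unmatched? I)
      ... | no none = record
        { involution = I
        ; matched    = λ v p → decidable-stable (v ~? mate v) λ ¬a →
            complete v (mate v) (p , supp (mate v) (λ e → none (v , p , trans (sym e) (involutive v)))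
                                , (λ e → none (v , p , sym e)) , ¬a)
        }
        where open Involution I
      ... | yes (x , px , ex) with any? (λ y → ¬? (y ≟ x) ×-dec unmatched? I y)
      ...   | yes (y , y≢x , py , ey) = greedy I′ supp′ (rec fewer)
        where
        open Involution I
        I′ = join I ex ey
        same : ∀ {v} → v ≢ x → v ≢ y → Involution.mate I′ v ≡ mate v
        same p q = swap-other (λ e → p (trans (sym (partner e)) ex)) (λ e → q (trans (sym (partner e)) ey))
        supp′ : ∀ v → Involution.mate I′ v ≢ v → P v
        supp′ v ne with v ≟ x | v ≟ y
        ... | yes refl | _        = px
        ... | no _     | yes refl = py
        ... | no p     | no q     = supp v λ e → ne (trans (same p q) e)
        x↦y : Involution.mate I′ x ≡ y
        x↦y = trans (cong (swap x y) ex) (swap-left x y)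
        y↦x : Involution.mate I′ y ≡ x
        y↦x = trans (cong (swap x y) ey) (swap-right x y)
        still : ∀ v → P v × Involution.mate I′ v ≡ v → P v × mate v ≡ v
        still v (p , e) = p , trans (sym (same (λ { refl → y≢x (trans (sym x↦y) e) })
                                               (λ { refl → y≢x (trans (sym e) y↦x) }))) e
        fewer : ∑ (λ v → ⟦ unmatched? I′ v ⟧) < ∑ (λ v → ⟦ unmatched? I v ⟧)
        fewer = ∑-mono-< (λ v → ⟦⟧-mono (unmatched? I′ v) (unmatched? I v) (still v)) x
          (subst₂ _<_ (sym (⟦⟧-no (unmatched? I′ x) λ (_ , e) → y≢x (trans (sym x↦y) e)))
                      (sym (⟦⟧-yes (unmatched? I x) (px , ex))) (s≤s z≤n))
      ...   | no only = contradiction (subst (2 ∣_) one even-unmatched) λ d → case ∣⇒≤ d of λ { (s≤s ()) }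
        where
        open Involution I
        one : ∑ (λ v → ⟦ unmatched? I v ⟧) ≡ 1
        one = ∑-unique≡1 (unmatched? I) (λ u u′ → trans (is-x u) (sym (is-x u′))) (x , px , ex)
          where
          is-x : ∀ {y} → P y × mate y ≡ y → y ≡ x
          is-x {y} u = decidable-stable (y ≟ x) λ ne → only (y , ne , u)
        split : ∑ (λ v → ⟦ P? v ⟧) ≡ ∑ (λ v → ⟦ ¬? (mate v ≟ v) ⟧) + ∑ (λ v → ⟦ unmatched? I v ⟧)
        split = trans (∑-cong λ v → ≤-antisym
            (⟦⟧-cover (P? v) (¬? (mate v ≟ v)) (unmatched? I v) λ p → case mate v ≟ v of λ
              { (yes e) → inj₂ (p , e) ; (no ne) → inj₁ ne })
            (⟦⟧-disjoint (P? v) (¬? (mate v ≟ v)) (unmatched? I v) (supp v) proj₁ λ ne (_ , e) → ne e))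
          (∑-distrib-+ (λ v → ⟦ ¬? (mate v ≟ v) ⟧) _)
        even-unmatched : 2 ∣ ∑ (λ v → ⟦ unmatched? I v ⟧)
        even-unmatched = ∣m+n∣m⇒∣n (subst (2 ∣_) split even) (even-matched I)

      perfect-matching : PerfectMatching A
      perfect-matching = greedy (record { mate = id ; involutive = λ _ → refl })
        (λ _ ne → contradiction refl ne) (<-wellFounded _)

    -- Lovász: in a graph to which no edge can be added without creating a perfect matching,
    -- either two crossing non-edges can be exchanged for edges, or the non-universal vertices
    -- form disjoint cliques.
    saturated : ∀ {w₁ w₂} (w : NonEdge A w₁ w₂) →
                (∀ u v (e : NonEdge A u v) → PerfectMatching (addEdge A e)) →
                PerfectMatching A ⊎ Barrier A
    saturated {w₁} {w₂} w pm with any? (λ a → any? λ b → any? λ c → any? λ d →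
      (a ~? b) ×-dec (b ~? c) ×-dec nonEdge? A a c ×-dec nonEdge? A b d)
    ... | yes (a , b , c , d , ab , bc , ac , bd) with perfect-or-near A bd (pm b d bd)
    ...   | inj₁ perfect = inj₁ perfect
    ...   | inj₂ near = inj₁ (Uncross.uncross A ab bc ac (pm a c ac)
                               (proj₁ (proj₂ bd)) (proj₁ (proj₂ (proj₂ bd))) near (<-wellFounded _))
    saturated {w₁} {w₂} w pm | no none with perfect-or-near A w (pm w₁ w₂ w)
    ...   | inj₁ perfect = inj₁ perfect
    ...   | inj₂ near = Cliques.matching-or-barrier w near ~-trans
      where
      ~-trans : ∀ {a b c} → ¬ Universal b → a ~ b → b ~ c → a ≢ c → a ~ c
      -- If `a` and `c` were not adjacent, a non-neighbour `d` of `b` would complete the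
      -- configuration that `none` excludes; so `b` would be universal.
      ~-trans {a} {b} {c} ¬u ab bc a≢c = decidable-stable (a ~? c) λ ¬ac →
        ¬u (~-supp bc , λ d pd d≢b → decidable-stable (b ~? d) λ ¬bd →
          none (a , b , c , d , ab , bc , (~-supp ab , ~-supp (~-sym bc) , a≢c , ¬ac)
                                        , (~-supp bc , pd , ≢-sym d≢b , ¬bd)))

  #nonEdges : SubGraph P → ℕ
  #nonEdges A = ∑ λ u → ∑ λ v → ⟦ nonEdge? A u v ⟧

  #nonEdges-addEdge : ∀ A {u v} (e : NonEdge A u v) → #nonEdges (addEdge A e) < #nonEdges A
  #nonEdges-addEdge A {u} {v} e = ∑-mono-< (λ a → ∑-mono (entry a)) u
    (∑-mono-< (entry u) v (subst₂ _<_
      (sym (⟦⟧-no (nonEdge? A′ u v) λ (_ , _ , _ , ¬a) → ¬a (inj₂ (inj₁ (refl , refl)))))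
      (sym (⟦⟧-yes (nonEdge? A u v) e)) (s≤s z≤n)))
    where
    A′ = addEdge A e
    entry : ∀ a b → ⟦ nonEdge? A′ a b ⟧ ≤ ⟦ nonEdge? A a b ⟧
    entry a b = ⟦⟧-mono (nonEdge? A′ a b) (nonEdge? A a b) λ (p , q , ne , ¬a) → p , q , ne , ¬a ∘ inj₁

  -- Induction on the number of non-edges. Either some one-edge extension has a barrier, which is
  -- inherited, or all have perfect matchings and the graph is saturated.
  tutte : 2 ∣ ∑ (λ v → ⟦ P? v ⟧) → ∀ A → PerfectMatching A ⊎ Barrier A
  tutte even A = go A (<-wellFounded _)
    where
    go : ∀ A → Acc _<_ (#nonEdges A) → PerfectMatching A ⊎ Barrier A
    go A (acc rec) =
      [ incomplete , (λ complete → inj₁ (Complete.perfect-matching A complete even)) ]′ nonEdge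
      where
      nonEdge : (∃[ u ] ∃[ v ] NonEdge A u v) ⊎ (∀ u v → ¬ NonEdge A u v)
      nonEdge with any? (λ u → any? (nonEdge? A u))
      ... | yes e = inj₁ e
      ... | no none = inj₂ λ u v e → none (u , v , e)
      extend : ∀ u v → ((e : NonEdge A u v) → PerfectMatching (addEdge A e)) ⊎ Barrier A
      extend u v with nonEdge? A u v
      ... | no ¬e = inj₁ λ e → contradiction e ¬e
      ... | yes e = Sum.map
        -- The adjacency of `addEdge` depends on `u` and `v` but not on the proof of `NonEdge`, so
        -- the same involution serves every such proof.
        (λ pm _ → record { involution = PerfectMatching.involution pm
                         ; matched    = PerfectMatching.matched pm })
        (barrier-addEdge A e) (go (addEdge A e) (rec (#nonEdges-addEdge A e)))
      incomplete : ∃[ u ] ∃[ v ] NonEdge A u v → PerfectMatching A ⊎ Barrier A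
      incomplete (_ , _ , w) = [ saturated A w , inj₂ ]′ (allOr λ u → allOr (extend u))

-- Cycles and edge cuts

mapCycle : {R R′ : Fin m → Fin m → Set} → (∀ {u v} → R u v → R′ u v) →
           ∀ {k} → CycleIn R k → CycleIn R′ k
mapCycle f C = record
  { vert = vert C ; vert-inj = vert-inj C ; vert-adj = λ i j e → f (vert-adj C i j e) }

module MinDegree {R : Fin m → Fin m → Set} (R-sym : ∀ {u v} → R u v → R v u) (R-irrefl : ∀ {v} → ¬ R v v)
  (C : Fin m → Set) (next : ∀ v x → C v → ∃[ y ] (y ≢ x × R v y × C y)) where

  close-cycle : (p : ℕ → Fin m) (l : ℕ) → (∀ {i j} → i ≤ 2 + l → j ≤ 2 + l → p i ≡ p j → i ≡ j) →
                (∀ i → i < 2 + l → R (p i) (p (suc i))) → R (p 0) (p (2 + l)) → CycleIn R l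
  close-cycle p l inj edge chord = record
    { vert     = p ∘ toℕ
    ; vert-inj = λ {i} {j} e → toℕ-injective (inj (ℕₚ.≤-pred (toℕ<n i)) (ℕₚ.≤-pred (toℕ<n j)) e)
    ; vert-adj = λ i j e → adjacent (toℕ<n i) e
    }
    where
    adjacent : ∀ {i j} → i < 3 + l → j ≡ suc i ℕ.% (3 + l) → R (p i) (p j)
    adjacent {i} {j} i< e with ℕₚ.m≤n⇒m<n∨m≡n i<
    ... | inj₁ lt = subst (R (p i) ∘ p) (sym (trans e (m<n⇒m%n≡m lt))) (edge i (ℕₚ.≤-pred lt))
    ... | inj₂ refl = subst (R (p i) ∘ p) (sym (trans e (n%n≡0 (3 + l)))) (R-sym chord)

  -- A path with no repeated vertex is extended at its head p 0; the neighbour of the head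
  -- differing from p 1 is either new or closes a cycle.
  extend-path : ∀ fuel k → m ≤ fuel + k → (p : ℕ → Fin m) → C (p 0) →
                (∀ {i j} → i ≤ k → j ≤ k → p i ≡ p j → i ≡ j) →
                (∀ i → i < k → R (p i) (p (suc i))) → HasCycle R
  extend-path zero k m≤k p c inj edge with pigeonhole (s≤s m≤k) (p ∘ toℕ)
  ... | i , j , i<j , e =
    contradiction (inj (ℕₚ.≤-pred (toℕ<n i)) (ℕₚ.≤-pred (toℕ<n j)) e) (ℕₚ.<⇒≢ i<j)
  extend-path (suc fuel) k m≤ p c inj edge with next (p 0) (p 1) c
  ... | y , y≢p1 , r , cy with any? (λ (i : Fin (suc k)) → p (toℕ i) ≟ y)
  ...   | yes (i , e) = back (toℕ i) (ℕₚ.≤-pred (toℕ<n i)) e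
    where
    back : ∀ i → i ≤ k → p i ≡ y → HasCycle R
    back 0 _ refl = contradiction r R-irrefl
    back 1 _ e = contradiction (sym e) y≢p1
    back (suc (suc l)) le refl = l , close-cycle p l
      (λ i≤ j≤ → inj (≤-trans i≤ le) (≤-trans j≤ le)) (λ i i< → edge i (<-≤-trans i< le)) r
  ...   | no new =
    extend-path fuel (suc k) (≤-trans m≤ (≤-reflexive (sym (ℕₚ.+-suc fuel k)))) q cy q-inj q-edge
    where
    q : ℕ → Fin m
    q zero    = y
    q (suc i) = p i
    fresh : ∀ {i} → i ≤ k → p i ≢ y
    fresh le e = new (fromℕ< (s≤s le) , trans (cong p (toℕ-fromℕ< (s≤s le))) e)
    q-inj : ∀ {i j} → i ≤ suc k → j ≤ suc k → q i ≡ q j → i ≡ j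
    q-inj {zero}  {zero}  _ _ _ = refl
    q-inj {zero}  {suc j} _ (s≤s le) e = contradiction (sym e) (fresh le)
    q-inj {suc i} {zero}  (s≤s le) _ e = contradiction e (fresh le)
    q-inj {suc i} {suc j} (s≤s le) (s≤s le′) e = cong suc (inj le le′ e)
    q-edge : ∀ i → i < suc k → R (q i) (q (suc i))
    q-edge zero    _        = R-sym r
    q-edge (suc i) (s≤s lt) = edge i lt

  has-cycle : ∀ {v} → C v → HasCycle R
  has-cycle {v} c =
    -- The path is the single vertex `v`. Its value at 1 lies beyond the end; taking it to be `v`
    -- merely asks `next` for a neighbour other than `v`.
    extend-path m 0 (≤-reflexive (sym (+-identityʳ m))) (λ _ → v) c (λ { z≤n z≤n _ → refl }) λ _ ()

length-filter : ∀ {A : Set} {Q : A → Set} (Q? : ∀ x → Dec (Q x)) xs →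
                length (filter Q? xs) ≡ ListAction.sum (map (λ x → ⟦ Q? x ⟧) xs)
length-filter Q? [] = refl
length-filter Q? (x ∷ xs) with Q? x
... | yes _ = cong suc (length-filter Q? xs)
... | no _  = length-filter Q? xs

sum-cartesianProduct : ∀ {A B : Set} (f : A × B → ℕ) xs ys →
  ListAction.sum (map f (cartesianProduct xs ys)) ≡
  ListAction.sum (map (λ x → ListAction.sum (map (λ y → f (x , y)) ys)) xs)
sum-cartesianProduct f [] ys = refl
sum-cartesianProduct f (x ∷ xs) ys =
  trans (cong ListAction.sum (map-++ f (map (x ,_) ys) _))
  (trans (sum-++ (map f (map (x ,_) ys)) _)
  (cong₂ _+_ (cong ListAction.sum (sym (map-∘ ys))) (sum-cartesianProduct f xs ys)))

∑-distribʳ-* : (f : Fin m → ℕ) (k : ℕ) → ∑ (λ i → f i * k) ≡ ∑ f * k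
∑-distribʳ-* {zero}  f k = refl
∑-distribʳ-* {suc m} f k =
  trans (cong (f zero * k +_) (∑-distribʳ-* (f ∘ suc) k)) (sym (ℕₚ.*-distribʳ-+ k (f zero) _))

∑-scaled-point : (x : Fin m) (k : ℕ) → ∑ (λ i → ⟦ i ≟ x ⟧ * k) ≡ k
∑-scaled-point x k =
  trans (∑-distribʳ-* (λ i → ⟦ i ≟ x ⟧) k) (trans (cong (_* k) (∑-point x)) (+-identityʳ k))

module Cubics (G : Graph) (cubic : Cubic G) where

  V : Set
  V = Fin (n G)

  edge? : ∀ u v → Dec (Edge G u v)
  edge? u v = adj G u v Bool.≟ true

  edge-sym : ∀ {u v} → Edge G u v → Edge G v u
  edge-sym {u} {v} e = trans (adj-sym G v u) e

  edge-irrefl : ∀ {v} → ¬ Edge G v v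
  edge-irrefl {v} e = case trans (sym e) (adj-irrefl G v) of λ ()

  ⟦≟true⟧ : ∀ b → ⟦ b Bool.≟ true ⟧ ≡ (if b then 1 else 0)
  ⟦≟true⟧ true  = refl
  ⟦≟true⟧ false = refl

  degree≡3 : ∀ v → ∑ (λ w → ⟦ edge? v w ⟧) ≡ 3
  degree≡3 v = trans (∑-cong λ w → ⟦≟true⟧ (adj G v w)) (trans (sym (sum-map-allFin (n G) _)) (cubic v))

  module _ {C : V → Set} (C? : ∀ v → Dec (C v)) where

    leaves? : ∀ u v → Dec (C u × ¬ C v × Edge G u v)
    leaves? u v = C? u ×-dec ¬? (C? v) ×-dec edge? u v

    cut : ℕ
    cut = ∑ λ u → ∑ λ v → ⟦ leaves? u v ⟧

    inner : V → ℕ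
    inner v = ∑ λ w → ⟦ edge? v w ×-dec C? w ⟧

    remove? : ∀ v u → Dec (C u × u ≢ v)
    remove? v u = C? u ×-dec ¬? (u ≟ v)

  -- If `v` has i neighbours inside, its removal takes the other 3 - i edges at `v` out of the cut
  -- and puts i edges in. The form with sums avoids truncated subtraction.
  cut-remove : ∀ {C : V → Set} (C? : ∀ v → Dec (C v)) {v} → C v →
               cut (remove? C? v) + 3 ≤ cut C? + (inner C? v + inner C? v)
  cut-remove {C} C? {v} c = begin
    cut (remove? C? v) + 3
      ≡⟨ cong (cut (remove? C? v) +_) (sym (∑-scaled-point v 3)) ⟩
    cut (remove? C? v) + ∑ (λ u → ⟦ u ≟ v ⟧ * 3)
      ≡⟨ sym (∑-distrib-+ (λ u → row′ u) _) ⟩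
    ∑ (λ u → row′ u + ⟦ u ≟ v ⟧ * 3)
      ≤⟨ ∑-mono bound ⟩
    ∑ (λ u → row u + (⟦ edge? v u ×-dec C? u ⟧ + ⟦ u ≟ v ⟧ * inner C? v))
      ≡⟨ ∑-distrib-+ row _ ⟩
    cut C? + ∑ (λ u → ⟦ edge? v u ×-dec C? u ⟧ + ⟦ u ≟ v ⟧ * inner C? v)
      ≡⟨ cong (cut C? +_) (∑-distrib-+ (λ u → ⟦ edge? v u ×-dec C? u ⟧) _) ⟩
    cut C? + (inner C? v + ∑ (λ u → ⟦ u ≟ v ⟧ * inner C? v))
      ≡⟨ cong (λ k → cut C? + (inner C? v + k)) (∑-scaled-point v _) ⟩
    cut C? + (inner C? v + inner C? v) ∎
    where
    open ≤-Reasoning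
    row row′ : V → ℕ
    row u = ∑ λ w → ⟦ leaves? C? u w ⟧
    row′ u = ∑ λ w → ⟦ leaves? (remove? C? v) u w ⟧
    row′-v : row′ v ≡ 0
    row′-v = ∑-zero λ w → ⟦⟧-no (leaves? (remove? C? v) v w) λ ((_ , ne) , _) → ne refl
    degree-v : 3 ≤ row v + inner C? v
    degree-v = begin
      3 ≡⟨ sym (degree≡3 v) ⟩
      ∑ (λ w → ⟦ edge? v w ⟧)
        ≤⟨ ∑-mono (λ w → ⟦⟧-cover (edge? v w) (leaves? C? v w) (edge? v w ×-dec C? w)
             λ e → case C? w of λ { (yes cw) → inj₂ (e , cw) ; (no ¬cw) → inj₁ (c , ¬cw , e) }) ⟩
      ∑ (λ w → ⟦ leaves? C? v w ⟧ + ⟦ edge? v w ×-dec C? w ⟧)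
        ≡⟨ ∑-distrib-+ (λ w → ⟦ leaves? C? v w ⟧) _ ⟩
      row v + inner C? v ∎
    row-other : ∀ u → row′ u ≤ row u + ⟦ edge? v u ×-dec C? u ⟧
    row-other u = begin
      row′ u
        ≤⟨ ∑-mono (λ w → ⟦⟧-cover (leaves? (remove? C? v) u w) (leaves? C? u w) (into? w)
             λ ((cu , _) , ¬cw , e) → case w ≟ v of λ
               { (yes refl) → inj₂ (refl , edge-sym e , cu)
               ; (no ne) → inj₁ (cu , (λ cw → ¬cw (cw , ne)) , e) }) ⟩
      ∑ (λ w → ⟦ leaves? C? u w ⟧ + ⟦ into? w ⟧)
        ≡⟨ ∑-distrib-+ (λ w → ⟦ leaves? C? u w ⟧) _ ⟩
      row u + ∑ (λ w → ⟦ into? w ⟧)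
        ≤⟨ +-monoʳ-≤ (row u) (∑-unique into? (λ (p , _) (q , _) → trans p (sym q))
             (edge? v u ×-dec C? u) (λ _ → proj₂)) ⟩
      row u + ⟦ edge? v u ×-dec C? u ⟧ ∎
      where
      into? : ∀ w → Dec (w ≡ v × Edge G v u × C u)
      into? w = (w ≟ v) ×-dec (edge? v u ×-dec C? u)
    -- The constants are charged to row `v`, so that the inequality can be checked row by row: row
    -- `v` vanishes, and any other row gains at most its edge to `v`.
    bound : ∀ u → row′ u + ⟦ u ≟ v ⟧ * 3 ≤ row u + (⟦ edge? v u ×-dec C? u ⟧ + ⟦ u ≟ v ⟧ * inner C? v)
    bound u = go (u ≟ v)
      where
      go : (d : Dec (u ≡ v)) → row′ u + ⟦ d ⟧ * 3 ≤ row u + (⟦ edge? v u ×-dec C? u ⟧ + ⟦ d ⟧ * inner C? v)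
      go (yes refl) = begin
        row′ v + 3 ≡⟨ cong (_+ 3) row′-v ⟩
        3 ≤⟨ degree-v ⟩
        row v + inner C? v ≡⟨ cong (row v +_) (sym (+-identityʳ _)) ⟩
        row v + 1 * inner C? v ≤⟨ +-monoʳ-≤ (row v) (m≤n+m _ ⟦ edge? v v ×-dec C? v ⟧) ⟩
        row v + (⟦ edge? v v ×-dec C? v ⟧ + 1 * inner C? v) ∎
      go (no _) = begin
        row′ u + 0 ≡⟨ +-identityʳ _ ⟩
        row′ u ≤⟨ row-other u ⟩
        row u + ⟦ edge? v u ×-dec C? u ⟧ ≡⟨ cong (row u +_) (sym (+-identityʳ _)) ⟩
        row u + (⟦ edge? v u ×-dec C? u ⟧ + 0) ∎

  module _ (connected : CyclicallyEdgeConnected 4 G) {k : ℕ} (H : CycleIn (Edge G) k) where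

    module _ {C : V → Set} (C? : ∀ v → Dec (C v)) (off : ∀ {v} → C v → ¬ OnCycle {G} H v) where

      -- Take for `F` the cut itself, each edge listed once from inside to outside. A cycle within
      -- `C` and the cycle `H` outside it both survive, yet no walk that avoids `F` leaves `C`.
      small-cut⇒acyclic : cut C? ≤ 3 → ¬ HasCycle (λ u v → Edge G u v × C u × C v)
      small-cut⇒acyclic small (l , D) =
        off (stays start (connected F (s≤s length-F) l k D′ H′)) (zero , refl)
        where
        leaves′? : (e : V × V) → Dec (C (proj₁ e) × ¬ C (proj₂ e) × Edge G (proj₁ e) (proj₂ e))
        leaves′? (u , v) = leaves? C? u v
        pairs F : List (V × V)
        pairs = cartesianProduct (allFin (n G)) (allFin (n G))
        F = filter leaves′? pairs
        ∈F⁺ : ∀ {u v} → C u → ¬ C v → Edge G u v → (u , v) ∈ F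
        ∈F⁺ {u} {v} c ¬c e = ∈-filter⁺ leaves′?
          (∈-cartesianProduct⁺ (∈-allFin u) (∈-allFin v)) (c , ¬c , e)
        ∈F⁻ : ∀ {u v} → (u , v) ∈ F → C u × ¬ C v
        ∈F⁻ i with c , ¬c , _ ← proj₂ (∈-filter⁻ leaves′? {xs = pairs} i) = c , ¬c
        length-F : length F ≤ 3
        length-F = ≤-trans (≤-reflexive (trans (length-filter leaves′? pairs)
          (trans (sum-cartesianProduct (λ e → ⟦ leaves′? e ⟧) (allFin (n G)) (allFin (n G)))
          (trans (sum-map-allFin (n G) _) (∑-cong {n G} λ u →
            sum-map-allFin (n G) λ v → ⟦ leaves? C? u v ⟧))))) small
        D′ : CycleIn (EdgeMinus G F) l
        D′ = mapCycle (λ (e , cu , cv) → e , (λ i → proj₂ (∈F⁻ i) cv) , (λ i → proj₂ (∈F⁻ i) cu)) D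
        H′ : CycleIn (EdgeMinus G F) k
        H′ = record { vert = vert H ; vert-inj = vert-inj H ; vert-adj = λ i j e →
          vert-adj H i j e , (λ x → off (proj₁ (∈F⁻ x)) (i , refl)) ,
          (λ x → off (proj₁ (∈F⁻ x)) (j , refl)) }
        start : C (vert D′ zero)
        start = proj₁ (proj₂ (vert-adj D zero (suc zero) refl))
        stays : ∀ {u v} → C u → Star (EdgeMinus G F) u v → C v
        stays c ε = c
        stays {u} c (_◅_ {j = w} (e , ∉F , _) s) =
          stays (decidable-stable (C? w) λ ¬c → ∉F (∈F⁺ c ¬c e)) s

      small-cut⇒leaf : cut C? ≤ 3 → ∃ C → ∃[ v ] (C v × inner C? v ≤ 1)
      small-cut⇒leaf small (_ , c) with any? (λ v → C? v ×-dec (inner C? v ℕ.≤? 1))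
      ... | yes r = r
      ... | no ¬r = contradiction (MinDegree.has-cycle
          (λ (e , cu , cv) → edge-sym e , cv , cu) (λ (e , _) → edge-irrefl e) C next c)
          (small-cut⇒acyclic small)
        where
        next : ∀ v x → C v → ∃[ y ] (y ≢ x × (Edge G v y × C v × C y) × C y)
        next v x cv
          with y , ne , e , cy ← ∃-other (λ w → edge? v w ×-dec C? w) (≰⇒> λ le → ¬r (v , cv , le)) x
          = y , ne , (e , cv , cy) , cy

    -- Induction on the bound `k`. Removing a vertex with at most one inner neighbour lowers the cut
    -- by at least 3 - 2 = 1, while a vertex alone in `C` already gives a cut of at least 3.
    cut≤2⇒empty : ∀ k {C : V → Set} (C? : ∀ v → Dec (C v)) → (∀ {v} → C v → ¬ OnCycle {G} H v) →
                  k ≤ 2 → cut C? ≤ k → ¬ ∃ C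
    cut≤2⇒empty k C? off k≤2 le ne
      with v , c , leaf ← small-cut⇒leaf C? off (≤-trans le (≤-trans k≤2 (s≤s (s≤s z≤n)))) ne
      with any? (remove? C? v)
    ... | no alone = contradiction (≤-trans (≤-trans (m≤n+m 3 _) (cut-remove C? c)) (≤-reflexive cut≡))
                                   (ℕₚ.<⇒≱ (s≤s (≤-trans le k≤2)))
      where
      inner≡0 : inner C? v ≡ 0
      inner≡0 = ∑-zero λ w → ⟦⟧-no (edge? v w ×-dec C? w) λ (e , cw) →
        alone (w , cw , λ { refl → edge-irrefl e })
      cut≡ : cut C? + (inner C? v + inner C? v) ≡ cut C?
      cut≡ = trans (cong (λ k → cut C? + (k + k)) inner≡0) (+-identityʳ _)
    ... | yes rest = smaller k k≤2 (≤-trans (+-cancelʳ-≤ 2 _ _ (≤-trans (≤-reflexive (+-assoc _ 1 2))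
        (≤-trans (cut-remove C? c) (+-monoʳ-≤ (cut C?) (+-mono-≤ leaf leaf))))) le)
      where
      smaller : ∀ k → k ≤ 2 → cut (remove? C? v) + 1 ≤ k → ⊥
      smaller zero    _   le = case ≤-trans (≤-reflexive (+-comm 1 _)) le of λ ()
      smaller (suc k) k≤2 le = cut≤2⇒empty k (remove? C? v) (λ (c , _) → off c) (≤-trans (ℕₚ.n≤1+n k) k≤2)
        (ℕₚ.≤-pred (≤-trans (≤-reflexive (+-comm 1 _)) le)) rest

    3≤cut : ∀ {C : V → Set} (C? : ∀ v → Dec (C v)) → (∀ {v} → C v → ¬ OnCycle {G} H v) → ∃ C → 3 ≤ cut C?
    3≤cut C? off ne = ≰⇒> λ le → cut≤2⇒empty 2 C? off ≤-refl le ne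

    -- Removing a vertex with at most one inner neighbour leaves a cut of at most 3 + 2 - 3 = 2,
    -- hence nothing.
    cut≡3⇒singleton : ∀ {C : V → Set} (C? : ∀ v → Dec (C v)) → (∀ {v} → C v → ¬ OnCycle {G} H v) →
                      cut C? ≡ 3 → ∀ {u v} → C u → C v → u ≡ v
    cut≡3⇒singleton {C} C? off eq {u} {v} cu cv
      with x , cx , leaf ← small-cut⇒leaf C? off (≤-reflexive eq) (u , cu) = trans (is-x cu) (sym (is-x cv))
      where
      smaller : cut (remove? C? x) ≤ 2
      smaller = +-cancelʳ-≤ 3 _ _
        (≤-trans (cut-remove C? cx) (+-mono-≤ (≤-reflexive eq) (+-mono-≤ leaf leaf)))
      is-x : ∀ {u} → C u → u ≡ x
      is-x {u} cu = decidable-stable (u ≟ x) λ ne →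
        cut≤2⇒empty 2 (remove? C? x) (λ (c , _) → off c) ≤-refl smaller (u , cu , ne)

-- The graph left after deleting the hexagon

does-true : (p : Dec P) → does p ≡ true → P
does-true (yes a) _ = a

does-cong : (p : Dec P) (q : Dec Q) → (P → Q) → (Q → P) → does p ≡ does q
does-cong p (yes b) f g = dec-true p (g b)
does-cong p (no ¬b) f g = dec-false p (¬b ∘ f)

module Hexagon (G : Graph) (cubic : Cubic G) (connected : CyclicallyEdgeConnected 4 G)
               (H : CycleIn (Edge G) 3) where

  open Cubics G cubic

  OnH Off : V → Set
  OnH = OnCycle {G} H
  Off v = ¬ OnH v

  onH? : ∀ v → Dec (OnH v)
  onH? v = any? λ i → vert H i ≟ v

  off? : ∀ v → Dec (Off v)
  off? v = ¬? (onH? v)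

  complement : SubGraph Off
  complement = record
    { _~_      = EdgeOff G H
    ; _~?_     = λ u v → edge? u v ×-dec off? u ×-dec off? v
    ; ~-sym    = λ (e , u , v) → edge-sym e , v , u
    ; ~-irrefl = λ (e , _) → edge-irrefl e
    ; ~-supp   = λ (_ , u , _) → u
    }

  open SubGraph complement using (PerfectMatching; Barrier)

  #H≡6 : ∑ (λ v → ⟦ onH? v ⟧) ≡ 6
  #H≡6 = trans (∑-cong λ v → ≤-antisym (lower v) (∑-unique (λ i → vert H i ≟ v)
                 (λ p q → vert-inj H (trans p (sym q))) (onH? v) _,_))
         (trans (∑-comm (λ v i → ⟦ vert H i ≟ v ⟧)) (∑-cong (λ i → ∑-point′ (vert H i))))
    where
    lower : ∀ v → ⟦ onH? v ⟧ ≤ ∑ (λ i → ⟦ vert H i ≟ v ⟧)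
    lower v = go (onH? v)
      where
      go : (d : Dec (OnH v)) → ⟦ d ⟧ ≤ ∑ (λ i → ⟦ vert H i ≟ v ⟧)
      go (yes (i , e)) =
        ≤-trans (≤-reflexive (sym (⟦⟧-yes (vert H i ≟ v) e))) (term≤∑ (λ i → ⟦ vert H i ≟ v ⟧) i)
      go (no _)        = z≤n

  even-order : 2 ∣ n G
  even-order = ∣m+n∣m⇒∣n (subst (2 ∣_) eq (handshake edge? edge-sym edge-irrefl)) (n∣m*n (n G))
    where
    eq : ∑ (λ u → ∑ λ v → ⟦ edge? u v ⟧) ≡ n G * 2 + n G
    eq = trans (∑-cong degree≡3) (trans (∑-const (n G) 3)
         (trans (ℕₚ.*-suc (n G) 2) (+-comm (n G) _)))

  even-off : 2 ∣ ∑ (λ v → ⟦ off? v ⟧)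
  even-off = ∣m+n∣m⇒∣n (subst (2 ∣_) order even-order) (divides 3 #H≡6)
    where
    order : n G ≡ ∑ (λ v → ⟦ onH? v ⟧) + ∑ (λ v → ⟦ off? v ⟧)
    order = trans (sym (trans (∑-const (n G) 1) (*-identityʳ (n G))))
            (trans (∑-cong one) (∑-distrib-+ (λ v → ⟦ onH? v ⟧) _))
      where
      one : ∀ v → 1 ≡ ⟦ onH? v ⟧ + ⟦ off? v ⟧
      one v = go (onH? v)
        where
        go : (d : Dec (OnH v)) → 1 ≡ ⟦ d ⟧ + ⟦ ¬? d ⟧
        go (yes _) = refl
        go (no _)  = refl

  two-neighbours : ∀ i → ∃[ j ] ∃[ k ]
    (j ≢ k × Edge G (vert H i) (vert H j) × Edge G (vert H k) (vert H i))
  two-neighbours 0F = 1F , 5F , (λ ()) , vert-adj H 0F 1F refl , vert-adj H 5F 0F refl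
  two-neighbours 1F = 2F , 0F , (λ ()) , vert-adj H 1F 2F refl , vert-adj H 0F 1F refl
  two-neighbours 2F = 3F , 1F , (λ ()) , vert-adj H 2F 3F refl , vert-adj H 1F 2F refl
  two-neighbours 3F = 4F , 2F , (λ ()) , vert-adj H 3F 4F refl , vert-adj H 2F 3F refl
  two-neighbours 4F = 5F , 3F , (λ ()) , vert-adj H 4F 5F refl , vert-adj H 3F 4F refl
  two-neighbours 5F = 0F , 4F , (λ ()) , vert-adj H 5F 0F refl , vert-adj H 4F 5F refl

  -- Two of the three edges at `v` go to its neighbours along the cycle.
  outer-degree≤1 : ∀ {v} → OnH v → ∑ (λ u → ⟦ edge? v u ×-dec off? u ⟧) ≤ 1
  outer-degree≤1 {v} (i , refl) with j , k , j≢k , e , e′ ← two-neighbours i = +-cancelʳ-≤ 2 _ _ (begin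
    ∑ outer + 2
      ≡⟨ cong₂ (λ a b → ∑ outer + (a + b)) (sym (∑-point a)) (sym (∑-point b)) ⟩
    ∑ outer + (∑ (λ u → ⟦ u ≟ a ⟧) + ∑ (λ u → ⟦ u ≟ b ⟧))
      ≡⟨ cong (∑ outer +_) (sym (∑-distrib-+ (λ u → ⟦ u ≟ a ⟧) _)) ⟩
    ∑ outer + ∑ (λ u → ⟦ u ≟ a ⟧ + ⟦ u ≟ b ⟧)
      ≡⟨ sym (∑-distrib-+ outer _) ⟩
    ∑ (λ u → outer u + (⟦ u ≟ a ⟧ + ⟦ u ≟ b ⟧))
      ≤⟨ ∑-mono bound ⟩
    ∑ (λ u → ⟦ edge? v u ⟧)
      ≡⟨ degree≡3 v ⟩
    3 ∎)
    where
    open ≤-Reasoning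
    a b : V
    a = vert H j
    b = vert H k
    outer : V → ℕ
    outer u = ⟦ edge? v u ×-dec off? u ⟧
    bound : ∀ u → outer u + (⟦ u ≟ a ⟧ + ⟦ u ≟ b ⟧) ≤ ⟦ edge? v u ⟧
    bound u = ≤-trans
      (+-monoʳ-≤ (outer u) (⟦⟧-disjoint ((u ≟ a) ⊎-dec (u ≟ b)) (u ≟ a) (u ≟ b) inj₁ inj₂
        λ { refl q → j≢k (vert-inj H q) }))
      (⟦⟧-disjoint (edge? v u) (edge? v u ×-dec off? u) ((u ≟ a) ⊎-dec (u ≟ b)) proj₁
        (λ { (inj₁ refl) → e ; (inj₂ refl) → edge-sym e′ })
        λ { (_ , off) (inj₁ refl) → off (j , refl) ; (_ , off) (inj₂ refl) → off (k , refl) })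

  matching⇒HasPerfectMatchingOff : PerfectMatching → HasPerfectMatchingOff G H
  matching⇒HasPerfectMatchingOff pm =
    (λ u v → does (M? u v)) ,
    (λ u v → does-cong (M? u v) (M? v u) M-sym M-sym) ,
    (λ u v e → M-edge (does-true (M? u v) e)) ,
    λ v off → trans (sum-map-allFin (n G) _)
      (∑-unique≡1 (M? v) (λ (_ , p) (_ , q) → trans (sym p) q) (mate v , off , refl))
    where
    open SubGraph.PerfectMatching pm
    M? : ∀ u v → Dec (Off u × mate u ≡ v)
    M? u v = off? u ×-dec (mate u ≟ v)
    M-edge : ∀ {u v} → Off u × mate u ≡ v → EdgeOff G H u v
    M-edge {u} (off , refl) = matched u off
    M-sym : ∀ {u v} → Off u × mate u ≡ v → Off v × mate v ≡ u
    M-sym m@(_ , e) = proj₂ (proj₂ (M-edge m)) , partner e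

  -- From a barrier to a bipartition by counting edges

  module Bipartition (barrier : Barrier) where
    open SubGraph.Barrier barrier

    -- With `T t` built in, the part of a vertex outside `T` is empty and has cut 0, so the sums can
    -- run over all vertices.
    part? : ∀ t v → Dec (T t × K t v)
    part? t v = T? t ×-dec K? t v

    part-off : ∀ {t v} → T t × K t v → Off v
    part-off (s , k) = proj₁ (inside s k)

    -- The places where an edge leaving a part can end. `Off u` discards the edges within the
    -- hexagon, which leaves at most one place at each of its vertices.
    absorbed? : ∀ u v → Dec (Edge G u v × (S v ⊎ (OnH v × Off u)))
    absorbed? u v = edge? u v ×-dec (S? v ⊎-dec (onH? v ×-dec off? u))

    leaving : V → V → ℕ
    leaving u v = ∑ λ t → ⟦ leaves? (part? t) u v ⟧

    leaving≤absorbed : ∀ u v → leaving u v ≤ ⟦ absorbed? u v ⟧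
    leaving≤absorbed u v = ∑-unique (λ t → leaves? (part? t) u v)
      (λ ((s , k) , _) ((s′ , k′) , _) → disjoint s s′ k k′) (absorbed? u v) target
      where
      target : ∀ t → (T t × K t u) × ¬ (T t × K t v) × Edge G u v → Edge G u v × (S v ⊎ (OnH v × Off u))
      target t (p@(s , k) , ¬q , e) with onH? v
      ... | yes h = e , inj₂ (h , part-off p)
      ... | no off = case closed s k (e , part-off p , off) of λ
        { (inj₁ k′) → contradiction (s , k′) ¬q ; (inj₂ sv) → e , inj₁ sv }

    three-per-part : ∀ t → ⟦ T? t ⟧ * 3 ≤ cut (part? t)
    three-per-part t = go (T? t)
      where
      go : (d : Dec (T t)) → ⟦ d ⟧ * 3 ≤ cut (part? t)
      go (yes s) = 3≤cut connected H (part? t) part-off (t , s , root s)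
      go (no _)  = z≤n

    absorbed-by : ∀ v → ∑ (λ u → ⟦ absorbed? u v ⟧) ≤ ⟦ S? v ⟧ * 3 + ⟦ onH? v ⟧
    absorbed-by v = go (S? v) (onH? v)
      where
      go : (d : Dec (S v)) (h : Dec (OnH v)) → ∑ (λ u → ⟦ absorbed? u v ⟧) ≤ ⟦ d ⟧ * 3 + ⟦ h ⟧
      go (yes _) _ = ≤-trans (∑-mono λ u → ⟦⟧-mono (absorbed? u v) (edge? v u) (λ (e , _) → edge-sym e))
        (≤-trans (≤-reflexive (degree≡3 v)) (m≤m+n 3 _))
      go (no ¬s) (yes h) = ≤-trans (∑-mono λ u → ⟦⟧-mono (absorbed? u v) (edge? v u ×-dec off? u)
        λ { (_ , inj₁ s) → contradiction s ¬s ; (e , inj₂ (_ , off)) → edge-sym e , off })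
        (outer-degree≤1 h)
      go (no ¬s) (no ¬h) = ≤-reflexive (∑-zero λ u → ⟦⟧-no (absorbed? u v)
        λ { (_ , inj₁ s) → ¬s s ; (_ , inj₂ (h , _)) → ¬h h })

    ∑-cuts : ∑ (λ t → cut (part? t)) ≡ ∑ (λ u → ∑ (leaving u))
    ∑-cuts = trans (∑-comm (λ t u → ∑ λ v → ⟦ leaves? (part? t) u v ⟧))
                   (∑-cong λ u → ∑-comm (λ t v → ⟦ leaves? (part? t) u v ⟧))

    absorbed≤ : ∑ (λ u → ∑ λ v → ⟦ absorbed? u v ⟧) ≤ ∑ (λ t → ⟦ T? t ⟧ * 3)
    absorbed≤ = begin
      ∑ (λ u → ∑ λ v → ⟦ absorbed? u v ⟧)
        ≡⟨ ∑-comm (λ u v → ⟦ absorbed? u v ⟧) ⟩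
      ∑ (λ v → ∑ λ u → ⟦ absorbed? u v ⟧)
        ≤⟨ ∑-mono absorbed-by ⟩
      ∑ (λ v → ⟦ S? v ⟧ * 3 + ⟦ onH? v ⟧)
        ≡⟨ ∑-distrib-+ (λ v → ⟦ S? v ⟧ * 3) _ ⟩
      ∑ (λ v → ⟦ S? v ⟧ * 3) + ∑ (λ v → ⟦ onH? v ⟧)
        ≡⟨ cong₂ _+_ (∑-distribʳ-* (λ v → ⟦ S? v ⟧) 3) #H≡6 ⟩
      ∑ (λ v → ⟦ S? v ⟧) * 3 + 6
        ≡⟨ +-comm _ 6 ⟩
      (2 + ∑ (λ v → ⟦ S? v ⟧)) * 3
        ≤⟨ ℕₚ.*-monoˡ-≤ 3 size ⟩
      ∑ (λ t → ⟦ T? t ⟧) * 3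
        ≡⟨ sym (∑-distribʳ-* (λ t → ⟦ T? t ⟧) 3) ⟩
      ∑ (λ t → ⟦ T? t ⟧ * 3) ∎
      where open ≤-Reasoning

    cut≡3 : ∀ {t} → T t → cut (part? t) ≡ 3
    cut≡3 {t} s = trans (sym (∑-tight three-per-part
        (≤-trans (≤-trans (≤-reflexive ∑-cuts) (∑-mono λ u → ∑-mono (leaving≤absorbed u))) absorbed≤) t))
      (cong (_* 3) (⟦⟧-yes (T? t) s))

    -- The estimates run in a circle from 3|T| through the sum of the cuts and the absorbed edges
    -- back to 3|T|. Equality of the totals passes to each row and then to each entry.
    leaving≡absorbed : ∀ u v → leaving u v ≡ ⟦ absorbed? u v ⟧
    leaving≡absorbed u = ∑-tight (leaving≤absorbed u) (≤-reflexive (sym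
      (∑-tight (λ u → ∑-mono (leaving≤absorbed u))
        (≤-trans absorbed≤ (≤-trans (∑-mono three-per-part) (≤-reflexive ∑-cuts))) u)))

    part≡singleton : ∀ {t u} → T t → K t u → t ≡ u
    part≡singleton {t} s k = cut≡3⇒singleton connected H (part? t) part-off (cut≡3 s) (s , root s) (s , k)

    -- By tightness every available place is used by an edge leaving some part. That part contains
    -- `u` and is a single vertex.
    absorbed⇒T : ∀ {u v} → Edge G u v → S v ⊎ (OnH v × Off u) → T u
    absorbed⇒T {u} {v} e a with any? (λ t → part? t u)
    ... | yes (t , s , k) = subst T (part≡singleton s k) s
    ... | no ¬t = case trans (sym (⟦⟧-yes (absorbed? u v) (e , a))) (trans (sym (leaving≡absorbed u v))
        (∑-zero λ t → ⟦⟧-no (leaves? (part? t) u v) λ (p , _) → ¬t (t , p))) of λ ()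

    rest? : ∀ v → Dec (Off v × ¬ S v × ¬ T v)
    rest? v = off? v ×-dec ¬? (S? v) ×-dec ¬? (T? v)

    -- An edge into `S` or the hexagon starts in `T`; an edge into a vertex of `T` starts, by
    -- `closed`, in its one-vertex part or in `S`. Neither can start in the rest.
    cut-rest≡0 : cut rest? ≡ 0
    cut-rest≡0 = ∑-zero λ u → ∑-zero λ v → ⟦⟧-no (leaves? rest? u v) (none u v)
      where
      none : ∀ u v → ¬ ((Off u × ¬ S u × ¬ T u) × ¬ (Off v × ¬ S v × ¬ T v) × Edge G u v)
      none u v ((off , ¬su , ¬tu) , ¬r , e) = ¬r
        ( off-v , (λ sv → ¬tu (absorbed⇒T e (inj₁ sv)))
        , λ tv → case closed tv (root tv) (edge-sym e , off-v , off) of λ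
            { (inj₁ k) → ¬tu (subst T (part≡singleton tv k) tv) ; (inj₂ su) → ¬su su })
        where
        off-v : Off v
        off-v h = ¬tu (absorbed⇒T e (inj₂ (h , off)))

    ¬S⇒T : ∀ {v} → Off v → ¬ S v → T v
    ¬S⇒T {v} off ¬s = decidable-stable (T? v) λ ¬t →
      cut≤2⇒empty connected H 0 rest? proj₁ z≤n (≤-reflexive cut-rest≡0) (v , off , ¬s , ¬t)

    bipartite : BipartiteOff G H
    bipartite = (λ v → does (S? v)) , proper
      where
      proper : ∀ u v → EdgeOff G H u v → does (S? u) ≢ does (S? v)
      proper u v a@(e , off-u , off-v) with S? u | S? v
      -- An edge inside `S` would be absorbed and so put `u` in `T`, but a part avoids `S`.
      ... | yes su | yes sv = λ _ → proj₂ (inside tu (root tu)) su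
        where tu = absorbed⇒T e (inj₁ sv)
      ... | yes _ | no _ = λ ()
      ... | no _ | yes _ = λ ()
      -- Here `u` is in `T` and alone in its part, so by `closed` its neighbour `v` equals `u` or
      -- lies in `S`.
      ... | no ¬su | no ¬sv = λ _ → case closed tu (root tu) a of λ
          { (inj₁ k) → edge-irrefl (subst (Edge G u) (sym (part≡singleton tu k)) e)
          ; (inj₂ sv) → ¬sv sv }
        where tu = ¬S⇒T off-u ¬su

  matching-or-bipartite : HasPerfectMatchingOff G H ⊎ BipartiteOff G H
  matching-or-bipartite =
    Sum.map matching⇒HasPerfectMatchingOff Bipartition.bipartite (Tutte.tutte off? even-off complement)

theorem2p2 : (G : Graph) → Cubic G → CyclicallyEdgeConnected 4 G →
    CycleIn (Edge G) 3 →
    (H : CycleIn (Edge G) 3) → HasPerfectMatchingOff G H ⊎ BipartiteOff G H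
theorem2p2 G cubic connected _ H = Hexagon.matching-or-bipartite G cubic connected H
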